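{- Every cycle $m$-pole $C_m$ with $m\ge 5$ is irreducible.
   Context: An $m$-pole ($m\ge 1$), or multipole, $M=(V,E,\mathcal{E})$ consists of a finite set $V=V(M)$ of vertices, a finite collection $E$ of edges (unordered pairs of vertices; parallel edges and loops may occur), and a set $\mathcal{E}=\{\epsilon_1,\dots,\epsilon_m\}$ of $m$ semiedges. Each semiedge is either incident to exactly one vertex, or is paired with another semiedge to form a free (isolated) edge, which has no vertices. All multipoles are cubic: for each vertex, the number of edges (loops counted twice) plus semiedges incident to it is $3$. A multipole may be disconnected, and $V$ may be empty. A Tait coloring of $M$ is a map $\phi:E\cup\mathcal{E}\to\{1,2,3\}$ such that the three edges/semiedges incident with any vertex receive distinct colors (so a multipole with a loop has none) and the two semiedges of any free edge receive the same color. $\mathrm{Col}(M)$ is the set of states of $M$, i.e. of tuples $(\phi(\epsilon_1),\dots,\phi(\epsilon_m))$ with $\phi$ a Tait coloring of $M$. The cycle $m$-pole $C_m$ consists of a cycle on $m$ vertices with exactly one semiedge attached to each vertex (and no free edges). An $m$-pole $M$ is reducible if there is an $m$-pole $N$ (with its semiedges numbered) such that $|V(N)|<|V(M)|$ and $\emptyset\ne\mathrm{Col}(N)\subseteq\mathrm{Col}(M)$; otherwise $M$ is irreducible. -}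

module Defs where

open import Level using (0ℓ)
open import Data.Bool.Base using (if_then_else_)
open import Data.Empty using (⊥-elim)
open import Data.Nat.Base using (ℕ; zero; suc; _+_; _<_)
open import Data.Nat.Properties using (+-0-commutativeMonoid; +-identityʳ)
open import Data.Fin.Base using (Fin; zero; suc; fromℕ; inject₁)
open import Data.Fin.Properties using (_≟_; suc-injective)
open import Data.Fin.Relation.Unary.Top
  using (view; ‵fromℕ; ‵inject₁; view-fromℕ; view-inject₁)
open import Data.Product.Base using (∃; ∃-syntax; _×_; _,_)
open import Data.Sum.Base using (_⊎_; inj₁; inj₂)
import Data.Sum.Properties as Sum
open import Data.Vec.Base using (Vec; tabulate)
open import Relation.Nullary using (¬_; Dec; yes; no; does)
open import Relation.Unary using (Pred; Satisfiable; _⊆_)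
open import Relation.Binary.PropositionalEquality
  using (_≡_; _≢_; refl; sym; trans; cong; cong₂)
open import Algebra.Properties.CommutativeMonoid.Sum +-0-commutativeMonoid
  using (sum-syntax; ∑-distrib-+; sum-cong-≗; sum-replicate-zero)

indicator : ∀ {p} {P : Set p} → Dec P → ℕ
indicator P? = if does P? then 1 else 0

-- The vertices, edges and semiedges are numbered by Fin nV, Fin nE and Fin m.
-- Edge e joins end e zero and end e (suc zero); the order of the two ends
-- plays no role, and they coincide when e is a loop.

record Multipole (m : ℕ) : Set where
  field
    nV  : ℕ
    nE  : ℕ
    end : Fin nE → Fin 2 → Fin nV

    -- inj₁ v : the semiedge is incident to the vertex v;
    -- inj₂ j : it forms a free edge together with the semiedge j.
    attach : Fin m → Fin nV ⊎ Fin m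

    free-distinct  : ∀ i j → attach i ≡ inj₂ j → i ≢ j
    free-symmetric : ∀ i j → attach i ≡ inj₂ j → attach j ≡ inj₂ i

  -- A loop at v contributes 2.
  degree : Fin nV → ℕ
  degree v = ∑[ e < nE ] (∑[ k < 2 ] indicator (end e k ≟ v))
           + ∑[ i < m ] indicator (Sum.≡-dec _≟_ _≟_ (attach i) (inj₁ v))

  field
    cubic : ∀ v → degree v ≡ 3

  -- The two ends of an edge are separate incidences, so that a loop at v is
  -- incident to v twice.
  Incidence : Set
  Incidence = (Fin nE × Fin 2) ⊎ Fin m

  at : Incidence → Fin nV ⊎ Fin m
  at (inj₁ (e , k)) = inj₁ (end e k)
  at (inj₂ i)       = attach i

  underlying : Incidence → Fin nE ⊎ Fin m
  underlying (inj₁ (e , _)) = inj₁ e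
  underlying (inj₂ i)       = inj₂ i

open Multipole public

Color : Set
Color = Fin 3

record TaitColoring {m : ℕ} (M : Multipole m) : Set where
  field
    color  : Fin (nE M) ⊎ Fin m → Color
    proper : ∀ v h h′ → at M h ≡ inj₁ v → at M h′ ≡ inj₁ v → h ≢ h′ →
             color (underlying M h) ≢ color (underlying M h′)
    free   : ∀ i j → attach M i ≡ inj₂ j → color (inj₂ i) ≡ color (inj₂ j)

  state : Vec Color m
  state = tabulate (λ i → color (inj₂ i))

open TaitColoring public

Col : ∀ {m} → Multipole m → Pred (Vec Color m) 0ℓ
Col M s = ∃[ φ ] state {M = M} φ ≡ s

Reducible : ∀ {m} → Multipole m → Set
Reducible {m} M =
  ∃[ N ] nV {m} N < nV M × Satisfiable (Col N) × Col N ⊆ Col M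

Irreducible : ∀ {m} → Multipole m → Set
Irreducible M = ¬ Reducible M

-- Cyclic successor: i ↦ i + 1 modulo m.
next : ∀ {m} → Fin m → Fin m
next {suc k} i with view i
... | ‵fromℕ     = zero
... | ‵inject₁ j = suc j

private
  prev : ∀ {m} → Fin m → Fin m
  prev {suc k} zero    = fromℕ k
  prev {suc k} (suc j) = inject₁ j

  next-prev : ∀ {m} (v : Fin m) → next (prev v) ≡ v
  next-prev {suc k} zero    rewrite view-fromℕ k   = refl
  next-prev {suc k} (suc j) rewrite view-inject₁ j = refl

  prev-next : ∀ {m} (i : Fin m) → prev (next i) ≡ i
  prev-next {suc k} i with view i
  ... | ‵fromℕ     = refl
  ... | ‵inject₁ j = refl

  indicator-yes : ∀ {p} {P : Set p} (P? : Dec P) → P → indicator P? ≡ 1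
  indicator-yes (yes _) _ = refl
  indicator-yes (no ¬p) p = ⊥-elim (¬p p)

  indicator-no : ∀ {p} {P : Set p} (P? : Dec P) → ¬ P → indicator P? ≡ 0
  indicator-no (yes p) ¬p = ⊥-elim (¬p p)
  indicator-no (no _)  _  = refl

  count-unique : ∀ {p} {n} {P : Fin n → Set p} (P? : ∀ i → Dec (P i)) i₀ →
                 P i₀ → (∀ i → P i → i ≡ i₀) →
                 ∑[ i < n ] indicator (P? i) ≡ 1
  count-unique {n = suc n} P? zero p u = cong₂ _+_
    (indicator-yes (P? zero) p)
    (trans (sum-cong-≗ (λ i → indicator-no (P? (suc i)) (λ q → 1+≢0 (u (suc i) q))))
           (sum-replicate-zero n))
    where
    1+≢0 : ∀ {i : Fin n} → suc i ≢ zero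
    1+≢0 ()
  count-unique {n = suc n} P? (suc i₀) p u = cong₂ _+_
    (indicator-no (P? zero) (λ q → 0≢1+ (u zero q)))
    (count-unique (λ i → P? (suc i)) i₀ p (λ i q → suc-injective (u (suc i) q)))
    where
    0≢1+ : ∀ {i : Fin n} → zero ≢ suc i
    0≢1+ ()

cycleEnd : ∀ {m} → Fin m → Fin 2 → Fin m
cycleEnd i zero       = i
cycleEnd i (suc zero) = next i

-- Semiedge i is attached to the i-th vertex along the cycle.  Reducibility
-- does not depend on the numbering of the semiedges.
C : (m : ℕ) → Multipole m
C m = record
  { nV             = m
  ; nE             = m
  ; end            = cycleEnd
  ; attach         = inj₁
  ; free-distinct  = λ _ _ ()
  ; free-symmetric = λ _ _ ()
  ; cubic          = λ v → cong₂ _+_ (edges v)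
      (count-unique (λ i → Sum.≡-dec _≟_ _≟_ (inj₁ i) (inj₁ v)) v refl
                    (λ _ → Sum.inj₁-injective {B = Fin m}))
  }
  where
  edges : ∀ v → ∑[ e < m ] (∑[ k < 2 ] indicator (cycleEnd e k ≟ v)) ≡ 2
  edges v =
    trans (∑-distrib-+ (λ e → indicator (e ≟ v))
                       (λ e → indicator (next e ≟ v) + 0))
      (cong₂ _+_
        (count-unique (_≟ v) v refl (λ _ eq → eq))
        (trans (sum-cong-≗ (λ e → +-identityʳ (indicator (next e ≟ v))))
          (count-unique (λ e → next e ≟ v) (prev v) (next-prev v)
            (λ e eq → trans (sym (prev-next e)) (cong prev eq)))))

{-# OPTIONS --safe #-}
module Submission where

-- Let N have fewer vertices than semiedges and Col(N) ⊆ Col(C_m).  By the pigeonhole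
-- principle two semiedges i, j of N form a free edge or share a vertex.  In either case,
-- exchanging two colours at i and j only turns a state of N into a state of N.
--
-- If s and s′ are states of C_m that differ only at i and j, then the colourings of the
-- cycle inducing them either agree along an arc between i and j, or disagree along all
-- of it, in which case s is constant on that arc.  They cannot agree on both arcs, so the
-- states of N are nearly constant on one of the arcs: this is Outcome below.  Kempe
-- chains in N, which exchange two colours at exactly two semiedges, give further states
-- of N, and these contradict such constancy as soon as m ≥ 5.

-- The far end of a Kempe chain is not under control, so every step must tolerate an arbitrary
-- partner position. This is workable because a switch alters only two positions: a constant arc can
-- change its colour only if it is very short.
--
-- Two semiedges at a common vertex have different colours in every state, whereas the ends of a
-- free edge have equal colours, which can moreover be chosen at will without touching the other
-- positions. Hence there are two separate contradictions.
--
-- In both, the configurations that resist the switches have no room for more than two positions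
-- besides i and j, and a fifth position finishes the proof. The bound is sharp: for m = 4, two free
-- edges that pair neighbouring semiedges have exactly the states (a, a, b, b), and all of these are
-- states of the 4-cycle.

open import Defs
open import Data.Empty using (⊥; ⊥-elim)
open import Data.Fin.Base using (Fin; zero; suc; toℕ; fromℕ; inject₁; opposite)
open import Data.Fin.Permutation.Components using (transpose; transpose-inverse)
open import Data.Fin.Properties
  using (_≟_; all?; any?; pigeonhole; suc-injective; opposite-involutive; <⇒≢;
         toℕ-injective; toℕ-inject₁; toℕ-fromℕ; toℕ<n; +↔⊎; *↔×)
open import Data.Fin.Relation.Unary.Top using (view; ‵fromℕ; ‵inject₁; view-fromℕ)
open import Data.List.Base using (List; []; _∷_; length; filter; concat; tabulate; _++_)
open import Data.List.Membership.Propositional.Properties using (∈-tabulate⁻; ∈-concat⁻′)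
open import Data.List.Properties using (filter-++; length-++)
open import Data.List.Relation.Binary.Disjoint.Propositional using (Disjoint)
open import Data.List.Relation.Unary.All using ([]; _∷_)
import Data.List.Relation.Unary.All.Properties as All
open import Data.List.Relation.Unary.AllPairs using ([]; _∷_)
import Data.List.Relation.Unary.AllPairs.Properties as AllPairs
open import Data.List.Relation.Unary.Unique.Propositional using (Unique)
import Data.List.Relation.Unary.Unique.Propositional.Properties as Unique
open import Data.Nat.Base
  using (ℕ; zero; suc; _+_; _*_; _≤_; _<_; _≤′_; ≤′-refl; ≤′-step; s≤s; s≤s⁻¹; z<s; s<s⁻¹)
open import Data.Nat.Properties
  using (≤⇒≤′; ≤′⇒≤; ≤-refl; ≤-reflexive; ≤-trans; <⇒≤; <-irrefl; ≤∧≢⇒<;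
         ≤-<-trans; <-≤-trans; <-trans; <-cmp; n<1+n; m≤n⇒m<n∨m≡n; anyUpTo?;
         +-comm; +-suc; +-identityʳ; +-monoˡ-<; +-monoˡ-≤; +-cancelˡ-<; m≤n+m;
         m≤n⇒∃[o]m+o≡n; +-0-commutativeMonoid)
open import Algebra.Properties.CommutativeMonoid.Sum +-0-commutativeMonoid
  using (sum-syntax; sum-cong-≗)
open import Data.Product.Base using (∃; ∃-syntax; _×_; _,_; proj₁; proj₂)
import Data.Product.Properties as Product
open import Data.Sum.Base as Sum using (_⊎_; inj₁; inj₂; [_,_]′)
import Data.Sum.Properties as Sum
open import Data.Vec.Base as Vec using () renaming ([] to []ᵥ; _∷_ to _∷ᵥ_)
open import Data.Vec.Properties using (lookup∘tabulate)
open import Function.Base using (_∘_; case_of_)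
open import Function.Bundles using (Injection; _↣_; Inverse; _↔_)
open import Relation.Binary.Definitions using (DecidableEquality; tri<; tri≈; tri>)
open import Relation.Binary.PropositionalEquality
  using (_≡_; _≢_; refl; sym; trans; cong; cong₂; subst; ≢-sym; module ≡-Reasoning)
open import Relation.Nullary using (¬_; Dec; yes; no; contradiction)
open import Relation.Nullary.Decidable
  using (toWitness; ¬?; _→-dec_; _⊎-dec_; _×-dec_; dec-true; dec-false)
open import Relation.Unary using (Decidable)

-- third x y is the colour other than x and y when x ≢ y; moreover third c c ≡ c,
-- so that third c is the transposition of the two colours other than c.
third : Color → Color → Color
third zero zero = zero
third zero (suc zero) = suc (suc zero)
third zero (suc (suc zero)) = suc zero
third (suc zero) zero = suc (suc zero)
third (suc zero) (suc zero) = suc zero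
third (suc zero) (suc (suc zero)) = zero
third (suc (suc zero)) zero = suc zero
third (suc (suc zero)) (suc zero) = zero
third (suc (suc zero)) (suc (suc zero)) = suc (suc zero)

third-idem : ∀ c → third c c ≡ c
third-idem = toWitness {a? = all? λ c → third c c ≟ c} _

third-comm : ∀ x y → third x y ≡ third y x
third-comm = toWitness {a? = all? λ x → all? λ y → third x y ≟ third y x} _

third-involutive : ∀ c x → third c (third c x) ≡ x
third-involutive =
  toWitness {a? = all? λ c → all? λ x → third c (third c x) ≟ x} _

third-≢ˡ : ∀ c x → x ≢ c → third c x ≢ c
third-≢ˡ = toWitness {a? = all? λ c → all? λ x →
  ¬? (x ≟ c) →-dec ¬? (third c x ≟ c)} _

third-≢ʳ : ∀ c x → x ≢ c → third c x ≢ x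
third-≢ʳ = toWitness {a? = all? λ c → all? λ x →
  ¬? (x ≟ c) →-dec ¬? (third c x ≟ x)} _

third-unique : ∀ x y z → x ≢ y → z ≢ x → z ≢ y → z ≡ third x y
third-unique = toWitness {a? = all? λ x → all? λ y → all? λ z →
  ¬? (x ≟ y) →-dec (¬? (z ≟ x) →-dec (¬? (z ≟ y) →-dec (z ≟ third x y)))} _

other : (c : Color) → ∃[ d ] d ≢ c
other zero    = suc zero , λ ()
other (suc _) = zero , λ ()

third-≡ : ∀ {x y z} → x ≢ y → z ≢ x → z ≢ y → third x y ≡ z
third-≡ {x} {y} {z} x≢y z≢x z≢y = sym (third-unique x y z x≢y z≢x z≢y)

third-injective : ∀ c {x y} → third c x ≡ third c y → x ≡ y
third-injective c {x} {y} eq =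
  trans (sym (third-involutive c x)) (trans (cong (third c) eq) (third-involutive c y))

≢⇒≡third⊎≡ : ∀ c x y → x ≢ c → y ≢ c → y ≡ x ⊎ y ≡ third c x
≢⇒≡third⊎≡ = toWitness {a? = all? λ c → all? λ x → all? λ y →
  ¬? (x ≟ c) →-dec (¬? (y ≟ c) →-dec ((y ≟ x) ⊎-dec (y ≟ third c x)))} _

-- Switches of states, and arcs of the cycle

State : ℕ → Set
State m = Fin m → Color

opaque

  switch : ∀ {m} → Color → Fin m → Fin m → State m → State m
  switch c p q s r with r ≟ p | r ≟ q
  ... | yes _ | _     = third c (s r)
  ... | no _  | yes _ = third c (s r)
  ... | no _  | no _  = s r

module _ {m} (c : Color) (p q : Fin m) (s : State m) where

  opaque
    unfolding switch

    switchˡ : switch c p q s p ≡ third c (s p)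
    switchˡ with p ≟ p | p ≟ q
    ... | yes _  | _ = refl
    ... | no p≢p | _ = contradiction refl p≢p

    switchʳ : switch c p q s q ≡ third c (s q)
    switchʳ with q ≟ p | q ≟ q
    ... | yes _ | _      = refl
    ... | no _  | yes _  = refl
    ... | no _  | no q≢q = contradiction refl q≢q

    switch-other : ∀ {r} → r ≢ p → r ≢ q → switch c p q s r ≡ s r
    switch-other {r} r≢p r≢q with r ≟ p | r ≟ q
    ... | yes r≡p | _       = contradiction r≡p r≢p
    ... | no _    | yes r≡q = contradiction r≡q r≢q
    ... | no _    | no _    = refl

    switch-fixed : ∀ {r} → s r ≡ c → switch c p q s r ≡ c
    switch-fixed {r} sr≡c with r ≟ p | r ≟ q
    ... | yes _ | _     = trans (cong (third c) sr≡c) (third-idem c)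
    ... | no _  | yes _ = trans (cong (third c) sr≡c) (third-idem c)
    ... | no _  | no _  = sr≡c

-- All that the combinatorial argument uses of Kempe chains. Nothing is known about `q`, except that
-- it is another position and carries one of the two switched colours.
KempeClosed : ∀ {m} → (State m → Set) → Set
KempeClosed S = ∀ {s} → S s → ∀ c p → s p ≢ c →
  ∃[ q ] q ≢ p × s q ≢ c × S (switch c p q s)

Constant : ∀ {m} → State m → (Fin m → Set) → Color → Set
Constant s A c = ∀ {p} → A p → s p ≡ c

-- A and B are the arcs into which the positions i and j cut the cycle, and b (a) is an
-- end of B (A), unless that arc is empty.
record CutOff {m} (s : State m) (c : Color) (i j : Fin m)
              (A B : Fin m → Set) (b : Fin m) : Set where
  field
    constant : Constant s A c
    boundary : s b ≢ c
    nonempty : s i ≢ s j → ∃ A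
open CutOff

-- Compare the edge colourings of the cycle before and after a switch at `i` and `j`. In the two
-- cutoff cases they disagree on one arc only, which is the constant one; in `twoColored` they
-- disagree along both arcs.
data Outcome {m} (s : State m) (c : Color) (i j : Fin m)
             (A B : Fin m → Set) (a b : Fin m) : Set where
  cutoffˡ : CutOff s c i j A B b → Outcome s c i j A B a b
  cutoffʳ : CutOff s c i j B A a → Outcome s c i j A B a b
  twoColored : ∀ {r r′} → r ≢ c → r′ ≢ c → r ≢ r′ →
    Constant s A r → Constant s B r′ → Outcome s c i j A B a b

-- The geometry of the cycle is forgotten here, so that the two ends and the two arcs play symmetric
-- roles. `flipEnds` and `swapArcs` then supply the mirror images of every argument. The arcs may be
-- empty, and `a` and `b` are tied to them only when they are not.
record Arcs {m} (S : State m → Set) : Set₁ where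
  field
    i j : Fin m
    A B : Fin m → Set
    a b : Fin m
    cover   : ∀ p → (p ≡ i ⊎ p ≡ j) ⊎ (A p ⊎ B p)
    A-≢i    : ∀ {p} → A p → p ≢ i
    A-≢j    : ∀ {p} → A p → p ≢ j
    B-≢i    : ∀ {p} → B p → p ≢ i
    B-≢j    : ∀ {p} → B p → p ≢ j
    A-end   : ∀ {p} → A p → A a
    B-end   : ∀ {p} → B p → B b
    outcome : ∀ {s} → S s → ∀ c → s i ≢ c → s j ≢ c → Outcome s c i j A B a b

flipCutOff : ∀ {m} {s : State m} {c i j A B b} →
             CutOff s c i j A B b → CutOff s c j i A B b
flipCutOff k = record
  { constant = constant k ; boundary = boundary k ; nonempty = nonempty k ∘ ≢-sym }

flipOutcome : ∀ {m} {s : State m} {c i j A B a b} →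
              Outcome s c i j A B a b → Outcome s c j i A B a b
flipOutcome (cutoffˡ k) = cutoffˡ (flipCutOff k)
flipOutcome (cutoffʳ k) = cutoffʳ (flipCutOff k)
flipOutcome (twoColored u v w x y) = twoColored u v w x y

swapOutcome : ∀ {m} {s : State m} {c i j A B a b} →
              Outcome s c i j A B a b → Outcome s c i j B A b a
swapOutcome (cutoffˡ k) = cutoffʳ k
swapOutcome (cutoffʳ k) = cutoffˡ k
swapOutcome (twoColored u v w x y) = twoColored v u (≢-sym w) y x

flipEnds : ∀ {m} {S : State m → Set} → Arcs S → Arcs S
flipEnds D = record
  { i = j ; j = i ; A = A ; B = B ; a = a ; b = b
  ; cover = λ p → Sum.map₁ Sum.swap (cover p)
  ; A-≢i = A-≢j ; A-≢j = A-≢i ; B-≢i = B-≢j ; B-≢j = B-≢i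
  ; A-end = A-end ; B-end = B-end
  ; outcome = λ h c u v → flipOutcome (outcome h c v u)
  }
  where open Arcs D

swapArcs : ∀ {m} {S : State m → Set} → Arcs S → Arcs S
swapArcs D = record
  { i = i ; j = j ; A = B ; B = A ; a = b ; b = a
  ; cover = λ p → Sum.map₂ Sum.swap (cover p)
  ; A-≢i = B-≢i ; A-≢j = B-≢j ; B-≢i = A-≢i ; B-≢j = A-≢j
  ; A-end = B-end ; B-end = A-end
  ; outcome = λ h c u v → swapOutcome (outcome h c u v)
  }
  where open Arcs D

-- Contradiction when the two cut positions never have equal colours

Roomy : ℕ → Set
Roomy m = (v : Fin 4 → Fin m) → ∃[ r ] (∀ k → r ≢ v k)

module _ {m} {S : State m → Set} (kempe : KempeClosed S) (room : Roomy m) where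

  room₂ : ∀ (i j p q : Fin m) → ∃[ r ] (r ≢ i × r ≢ j) × (r ≢ p × r ≢ q)
  room₂ i j p q with r , r≢ ← room (Vec.lookup (i ∷ᵥ j ∷ᵥ p ∷ᵥ q ∷ᵥ []ᵥ)) =
    r , (r≢ zero , r≢ (suc zero)) , (r≢ (suc (suc zero)) , r≢ (suc (suc (suc zero))))

  Distinct : Arcs S → Set
  Distinct D = ∀ {s} → S s → s (Arcs.i D) ≢ s (Arcs.j D)

  -- Switch at `i` fixing the colour of `j`: the partner `q` must lie on `A`, as all of `B` is
  -- fixed. For the colour that `i` just lost, neither arc can be cut off, so `A` is constant in
  -- another colour; but its positions other than `q` still have the old one.
  twoColored-singleton : (D : Arcs S) → Distinct D → let open Arcs D in
    ∀ {s} → S s → Constant s A (s i) → Constant s B (s j) →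
    ∃[ q ] (∀ {p} → A p → p ≡ q)
  twoColored-singleton D dist {s} Ss sA sB
    with kempe Ss (s (Arcs.j D)) (Arcs.i D) (dist Ss)
  ... | q , q≢i , sq≢ , Ss′ = q , only
    where
    open Arcs D
    x = s i
    y = s j
    s′ = switch y i q s
    Aq : A q
    Aq with cover q
    ... | inj₁ (inj₁ q≡i) = contradiction q≡i q≢i
    ... | inj₁ (inj₂ refl) = contradiction refl sq≢
    ... | inj₂ (inj₁ h) = h
    ... | inj₂ (inj₂ h) = contradiction (sB h) sq≢
    s′i≢x : s′ i ≢ x
    s′i≢x eq = third-≢ʳ y x (dist Ss) (trans (sym (switchˡ y i q s)) eq)
    s′j≡y : s′ j ≡ y
    s′j≡y = switch-fixed y i q s refl
    s′q≢x : s′ q ≢ x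
    s′q≢x eq = third-≢ʳ y x (dist Ss)
      (trans (cong (third y) (sym (sA Aq))) (trans (sym (switchʳ y i q s)) eq))
    only : ∀ {p} → A p → p ≡ q
    only {p} Ap with p ≟ q
    ... | yes p≡q = p≡q
    ... | no p≢q with outcome Ss′ x s′i≢x (λ eq → dist Ss (trans (sym eq) s′j≡y))
    ...   | cutoffˡ k = contradiction (constant k Aq) s′q≢x
    ...   | cutoffʳ k with r , Br ← nonempty k (dist Ss′) =
      contradiction (trans (sym (constant k Br)) (switch-fixed y i q s (sB Br))) (dist Ss)
    ...   | twoColored r≢x _ _ A≡r _ =
      contradiction (trans (sym (A≡r Ap)) (trans (switch-other y i q s (A-≢i Ap) p≢q) (sA Ap))) r≢x

  ¬twoColored : (D : Arcs S) → Distinct D → let open Arcs D in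
    ∀ {s} → S s → Constant s A (s i) → Constant s B (s j) → ⊥
  ¬twoColored D dist Ss sA sB
    with twoColored-singleton D dist Ss sA sB
       | twoColored-singleton (flipEnds (swapArcs D)) (λ h → ≢-sym (dist h)) Ss sB sA
  ... | q , A⊆q | q′ , B⊆q′
    with r , (r≢i , r≢j) , (r≢q , r≢q′) ← room₂ (Arcs.i D) (Arcs.j D) q q′
    with Arcs.cover D r
  ... | inj₁ (inj₁ r≡i) = r≢i r≡i
  ... | inj₁ (inj₂ r≡j) = r≢j r≡j
  ... | inj₂ (inj₁ h) = r≢q (A⊆q h)
  ... | inj₂ (inj₂ h) = r≢q′ (B⊆q′ h)

  -- In the `twoColored` outcome the arcs carry the two colours other than `c`, and so do `i` and
  -- `j`. Up to exchanging the arcs, this is the configuration excluded by `¬twoColored`.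
  arcCutOff : (D : Arcs S) → Distinct D → let open Arcs D in
    ∀ {s} → S s → ∀ c → s i ≢ c → s j ≢ c →
    CutOff s c i j A B b ⊎ CutOff s c i j B A a
  arcCutOff D dist {s} Ss c i≢c j≢c with Arcs.outcome D Ss c i≢c j≢c
  ... | cutoffˡ k = inj₁ k
  ... | cutoffʳ k = inj₂ k
  ... | twoColored {r} {r′} r≢c r′≢c r≢r′ A≡r B≡r′
    with ≢⇒≡third⊎≡ c (s i) r i≢c r≢c | ≢⇒≡third⊎≡ c (s i) r′ i≢c r′≢c
       | ≢⇒≡third⊎≡ c (s i) (s j) i≢c j≢c
    where open Arcs D
  ... | _          | _           | inj₁ j≡i  = contradiction (sym j≡i) (dist Ss)
  ... | inj₁ refl  | inj₁ refl   | _         = contradiction refl r≢r′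
  ... | inj₂ refl  | inj₂ refl   | _         = contradiction refl r≢r′
  ... | inj₁ refl  | inj₂ r′≡    | inj₂ j≡   =
    ⊥-elim (¬twoColored D dist Ss A≡r (λ h → trans (B≡r′ h) (trans r′≡ (sym j≡))))
  ... | inj₂ r≡    | inj₁ refl   | inj₂ j≡   =
    ⊥-elim (¬twoColored (swapArcs D) dist Ss B≡r′ (λ h → trans (A≡r h) (trans r≡ (sym j≡))))

  module _ (D : Arcs S) (dist : Distinct D) {s} (Ss : S s) {z}
           (z≢x : z ≢ s (Arcs.i D)) (z≢y : z ≢ s (Arcs.j D))
           (k : CutOff s z (Arcs.i D) (Arcs.j D) (Arcs.A D) (Arcs.B D) (Arcs.b D)) where
    open Arcs D

    private
      x = s i
      y = s j
      q = proj₁ (kempe Ss y i (dist Ss))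
      Aa : A a
      Aa = A-end (proj₂ (nonempty k (dist Ss)))

    switchedState : State m
    switchedState = switch y i q s

    switched∈S : S switchedState
    switched∈S = proj₂ (proj₂ (proj₂ (kempe Ss y i (dist Ss))))

    private
      s′ = switchedState
      s′∈S = switched∈S

      s′i≡z : s′ i ≡ z
      s′i≡z = trans (switchˡ y i q s) (third-≡ (≢-sym (dist Ss)) z≢y z≢x)

      s′j≡y : s′ j ≡ y
      s′j≡y = switch-fixed y i q s refl

    Singleton : (Fin m → Set) → Set
    Singleton A = ∃[ u ] (∀ {p} → A p → p ≡ u)

    -- The switch turns `i` into `z` and changes one more position, `q`. If `A` is now constantly
    -- `x`, each of its positions must have changed from `z`, so only `q` is left; as `b` is then
    -- not `q`, it has kept its colour.
    afterSwitch : (Singleton A × (B b → s b ≢ x)) ⊎ CutOff switchedState x i j B A a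
    afterSwitch with arcCutOff D dist s′∈S x (z≢x ∘ trans (sym s′i≡z))
                               (λ eq → dist Ss (trans (sym eq) s′j≡y))
    ... | inj₂ k′ = inj₂ k′
    ... | inj₁ k′ = inj₁ ((q , only) , edge)
      where
      only : ∀ {p} → A p → p ≡ q
      only {p} Ap with p ≟ q
      ... | yes p≡q = p≡q
      ... | no p≢q = contradiction
        (trans (sym (constant k Ap))
          (trans (sym (switch-other y i q s (A-≢i Ap) p≢q)) (constant k′ Ap)))
        z≢x
      edge : B b → s b ≢ x
      edge Bb sb≡x with b ≟ q
      ... | no b≢q = boundary k′ (trans (switch-other y i q s (B-≢i Bb) b≢q) sb≡x)
      ... | yes b≡q = boundary k (trans (cong s (trans b≡q (sym (only Aa)))) (constant k Aa))

    -- Now `i` is `z`, `j` is `y` and `B` is constantly `x`. Switch at `j` fixing `z`, and ask which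
    -- arc is constantly `y`. Not `A`, since `a` is `z` and stays so. If it is `B`, all of `B` has
    -- changed, hence `B` has at most the partner `v`, and the cycle has at most four positions.
    singleton⇒⊥ : Singleton A → CutOff switchedState x i j B A a → ⊥
    singleton⇒⊥ (u , A⊆u) k′
      with kempe s′∈S z j (λ eq → z≢y (trans (sym eq) s′j≡y))
    ... | v , v≢j , s′v≢z , Ss″
      with arcCutOff D dist Ss″ y
             (λ eq → z≢y (trans (sym s″i≡z) eq)) (λ eq → dist Ss (trans (sym s″j≡x) eq))
      where
      s″i≡z : switch z j v s′ i ≡ z
      s″i≡z = switch-fixed z j v s′ s′i≡z
      s″j≡x : switch z j v s′ j ≡ x
      s″j≡x = trans (switchˡ z j v s′)
        (trans (cong (third z) s′j≡y) (third-≡ z≢y (≢-sym z≢x) (dist Ss)))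
    ... | inj₁ k″ =
      z≢y (trans (sym (switch-fixed z j v s′ s′a≡z)) (constant k″ Aa))
      where
      a≢q : a ≢ q
      a≢q a≡q = boundary k′ (trans (cong s′ a≡q) (trans (switchʳ y i q s)
        (trans (cong (third y) (trans (cong s (sym a≡q)) (constant k Aa)))
          (third-≡ (≢-sym z≢y) (dist Ss) (≢-sym z≢x)))))
      s′a≡z : s′ a ≡ z
      s′a≡z = trans (switch-other y i q s (A-≢i Aa) a≢q) (constant k Aa)
    ... | inj₂ k″
      with r , (r≢i , r≢j) , (r≢u , r≢v) ← room₂ i j u v
      with cover r
    ... | inj₁ (inj₁ r≡i) = r≢i r≡i
    ... | inj₁ (inj₂ r≡j) = r≢j r≡j
    ... | inj₂ (inj₁ Ar) = r≢u (A⊆u Ar)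
    ... | inj₂ (inj₂ Br) = dist Ss (trans (sym (constant k′ Br))
      (trans (sym (switch-other z j v s′ r≢j r≢v)) (constant k″ Br)))

  -- Let x, y, z be the colours of i, of j and of A.  A Kempe switch at i fixing y must
  -- either leave B constantly x or show that A is a single position, and likewise for a
  -- switch at j fixing x.  If A is a single position in both cases, then the end of B
  -- has none of the three colours.
  cutOff⇒⊥ : (D : Arcs S) → Distinct D → let open Arcs D in
    ∀ {s} → S s → ∀ {z} → z ≢ s i → z ≢ s j → CutOff s z i j A B b → ⊥
  cutOff⇒⊥ D dist {s} Ss z≢x z≢y k
    with afterSwitch D dist Ss z≢x z≢y k
       | afterSwitch (flipEnds D) (≢-sym ∘ dist) Ss z≢y z≢x (flipCutOff k)
  ... | inj₁ (A⊆u , _) | inj₂ k″ =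
    singleton⇒⊥ (flipEnds D) (≢-sym ∘ dist) Ss z≢y z≢x (flipCutOff k) A⊆u k″
  ... | inj₂ k′ | inj₁ (A⊆u , _) = singleton⇒⊥ D dist Ss z≢x z≢y k A⊆u k′
  -- `B` is constantly `s i` after the first switch and constantly `s j` after the second. The first
  -- fixes every position coloured `s j`, the second every position coloured `s i`, so `b` had
  -- neither colour; and `boundary k` excludes the third.
  ... | inj₂ k′ | inj₂ k″ = sb≢y sb≡y
    where
    open Arcs D
    Bb : B b
    Bb = B-end (proj₂ (nonempty k′ (dist (switched∈S D dist Ss z≢x z≢y k))))
    sb≢y : s b ≢ s j
    sb≢y eq = dist Ss (trans (sym (constant k′ Bb)) (switch-fixed _ _ _ s eq))
    sb≢x : s b ≢ s i
    sb≢x eq = dist Ss (trans (sym (switch-fixed _ _ _ s eq)) (constant k″ Bb))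
    sb≡y : s b ≡ s j
    sb≡y = trans (third-unique _ _ _ z≢x (boundary k) sb≢x)
      (third-≡ z≢x (≢-sym z≢y) (≢-sym (dist Ss)))
  ... | inj₁ ((u , A⊆u) , b≢x) | inj₁ (_ , b≢y)
    with r , (r≢i , r≢j) , (r≢u , _) ← room₂ (Arcs.i D) (Arcs.j D) u u
    with Arcs.cover D r
  ... | inj₁ (inj₁ r≡i) = r≢i r≡i
  ... | inj₁ (inj₂ r≡j) = r≢j r≡j
  ... | inj₂ (inj₁ Ar) = r≢u (A⊆u Ar)
  ... | inj₂ (inj₂ Br) = boundary k
    (trans (third-unique _ _ _ (dist Ss) (b≢x Bb) (b≢y Bb)) (third-≡ (dist Ss) z≢x z≢y))
    where
    Bb = Arcs.B-end D Br

  cherry⇒⊥ : (D : Arcs S) → Distinct D → ∀ {s} → ¬ S s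
  cherry⇒⊥ D dist {s} Ss with arcCutOff D dist Ss z (≢-sym z≢x) (≢-sym z≢y)
    where
    open Arcs D
    z = third (s i) (s j)
    z≢x : z ≢ s i
    z≢x = third-≢ˡ (s i) (s j) (≢-sym (dist Ss))
    z≢y : z ≢ s j
    z≢y = third-≢ʳ (s i) (s j) (≢-sym (dist Ss))
  ... | inj₁ k = cutOff⇒⊥ D dist Ss
    (third-≢ˡ _ _ (≢-sym (dist Ss))) (third-≢ʳ _ _ (≢-sym (dist Ss))) k
  ... | inj₂ k = cutOff⇒⊥ (swapArcs D) dist Ss
    (third-≢ˡ _ _ (≢-sym (dist Ss))) (third-≢ʳ _ _ (≢-sym (dist Ss))) k

  -- Contradiction when the two cut positions can be recoloured together

  Recolorable : Arcs S → Set
  Recolorable D = let open Arcs D in ∀ {s} → S s → ∀ c →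
    ∃[ s′ ] S s′ × (s′ i ≡ c × s′ j ≡ c) × (∀ {r} → r ≢ i → r ≢ j → s′ r ≡ s r)

  module _ (D : Arcs S) (recolor : Recolorable D) {s} (Ss : S s) where
    open Arcs D

    -- Recolouring `i` and `j` away from `s a` makes `outcome` applicable to the colour `s a`
    -- itself. Its `boundary` at `a` then rules out `cutoffʳ`, and each of the other outcomes makes
    -- `A` constant.
    constantArc : Constant s A (s a)
    constantArc {p} Ap with recolor Ss d
      where d = proj₁ (other (s a))
    ... | s′ , Ss′ , (s′i≡d , s′j≡d) , same
      with outcome Ss′ (s a)
             (λ eq → proj₂ (other (s a)) (trans (sym s′i≡d) eq))
             (λ eq → proj₂ (other (s a)) (trans (sym s′j≡d) eq))
    ... | cutoffˡ k = trans (sym (same (A-≢i Ap) (A-≢j Ap))) (constant k Ap)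
    ... | cutoffʳ k = contradiction (same (A-≢i Aa) (A-≢j Aa)) (boundary k)
      where Aa = A-end Ap
    ... | twoColored _ _ _ A≡r _ =
      trans (sym (same (A-≢i Ap) (A-≢j Ap))) (trans (A≡r Ap)
        (trans (sym (A≡r (A-end Ap))) (same (A-≢i (A-end Ap)) (A-≢j (A-end Ap)))))

    differentArcs : A a → B b → s a ≢ s b
    differentArcs Aa Bb sa≡sb with recolor Ss d
      where d = proj₁ (other (s a))
    ... | s′ , Ss′ , (s′i≡d , s′j≡d) , same
      with outcome Ss′ (s a)
             (λ eq → proj₂ (other (s a)) (trans (sym s′i≡d) eq))
             (λ eq → proj₂ (other (s a)) (trans (sym s′j≡d) eq))
    ... | cutoffˡ k = boundary k (trans (same (B-≢i Bb) (B-≢j Bb)) (sym sa≡sb))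
    ... | cutoffʳ k = boundary k (same (A-≢i Aa) (A-≢j Aa))
    ... | twoColored _ _ r≢r′ A≡r B≡r′ = r≢r′ (trans (sym (A≡r Aa))
      (trans (same (A-≢i Aa) (A-≢j Aa)) (trans sa≡sb
        (trans (sym (same (B-≢i Bb) (B-≢j Bb))) (B≡r′ Bb)))))

  module _ (D : Arcs S) (recolor : Recolorable D) {s} (Ss : S s) where
    open Arcs D

    -- Switch at `p` so that it becomes `β`. Since `A` stays constant, `q` must change too, so it is
    -- the partner and `r` is untouched. If `r` is on `A`, it still has the old colour; if it is on
    -- `B`, both arcs now have colour `β`, against `differentArcs`.
    longArc⇒⊥ : ∀ {p q r} β → A p → A q → p ≢ q → r ≢ p → r ≢ q →
                β ≢ s p → (A r ⊎ B r × s r ≡ β) → ⊥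
    longArc⇒⊥ {p} {q} {r} β Ap Aq p≢q r≢p r≢q β≢α where-r
      with recolor Ss (third (s p) β)
    ... | s₀ , Ss₀ , (s₀i≡c , s₀j≡c) , same
      with kempe Ss₀ (third (s p) β) p s₀p≢c
      where
      s₀p≢c : s₀ p ≢ third (s p) β
      s₀p≢c eq = third-≢ˡ (s p) β β≢α (trans (sym eq) (same (A-≢i Ap) (A-≢j Ap)))
    ... | v , v≢p , s₀v≢c , Ss₁ = r-case where-r
      where
      c = third (s p) β
      s₁ = switch c p v s₀
      s₁p≡β : s₁ p ≡ β
      s₁p≡β = trans (switchˡ c p v s₀) (trans (cong (third c) (same (A-≢i Ap) (A-≢j Ap)))
        (third-≡ (third-≢ˡ (s p) β β≢α) (≢-sym (third-≢ʳ (s p) β β≢α)) β≢α))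
      A-same : ∀ {t} → A t → s₁ t ≡ β
      A-same At = trans (constantArc D recolor Ss₁ At)
        (trans (sym (constantArc D recolor Ss₁ Ap)) s₁p≡β)
      unswitched : ∀ {t} → A t → t ≢ p → t ≢ v → ⊥
      unswitched At t≢p t≢v = β≢α (trans (sym (A-same At))
        (trans (switch-other c p v s₀ t≢p t≢v) (trans (same (A-≢i At) (A-≢j At))
          (trans (constantArc D recolor Ss At) (sym (constantArc D recolor Ss Ap))))))
      q≡v : q ≡ v
      q≡v with q ≟ v
      ... | yes eq = eq
      ... | no q≢v = ⊥-elim (unswitched Aq (≢-sym p≢q) q≢v)
      r≢v : r ≢ v
      r≢v r≡v = r≢q (trans r≡v (sym q≡v))
      r-case : A r ⊎ B r × s r ≡ β → ⊥
      r-case (inj₁ Ar) = unswitched Ar r≢p r≢v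
      r-case (inj₂ (Br , sr≡β)) = differentArcs D recolor Ss₁ (A-end Ap) (B-end Br)
        (trans (A-same (A-end Ap)) (trans (sym sr≡β)
          (trans (sym (same (B-≢i Br) (B-≢j Br)))
          (trans (sym (switch-other c p v s₀ r≢p r≢v)) (constantArc (swapArcs D) recolor Ss₁ Br)))))

    twoOnArc⇒⊥ : ∀ {p q r} → A p → A q → p ≢ q → r ≢ p → r ≢ q → A r ⊎ B r → ⊥
    twoOnArc⇒⊥ Ap Aq p≢q r≢p r≢q (inj₁ Ar) =
      longArc⇒⊥ _ Ap Aq p≢q r≢p r≢q (proj₂ (other _)) (inj₁ Ar)
    twoOnArc⇒⊥ Ap Aq p≢q r≢p r≢q (inj₂ Br) =
      longArc⇒⊥ _ Ap Aq p≢q r≢p r≢q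
        (λ eq → differentArcs D recolor Ss (A-end Ap) (B-end Br)
          (trans (sym (constantArc D recolor Ss Ap))
            (trans (sym eq) (constantArc (swapArcs D) recolor Ss Br))))
        (inj₂ (Br , refl))

  -- Of three positions other than `i` and `j`, two lie on the same arc, and the remaining one
  -- serves as `r` in `twoOnArc⇒⊥`.
  free⇒⊥ : (D : Arcs S) → Recolorable D → ∀ {s} → ¬ S s
  free⇒⊥ D recolor Ss
    with p , (p≢i , p≢j) , _ ← room₂ (Arcs.i D) (Arcs.j D) (Arcs.i D) (Arcs.j D)
    with q , (q≢i , q≢j) , (q≢p , _) ← room₂ (Arcs.i D) (Arcs.j D) p p
    with r , (r≢i , r≢j) , (r≢p , r≢q) ← room₂ (Arcs.i D) (Arcs.j D) p q
    = go (onArc p≢i p≢j) (onArc q≢i q≢j) (onArc r≢i r≢j)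
    where
    open Arcs D
    onArc : ∀ {p} → p ≢ i → p ≢ j → A p ⊎ B p
    onArc {p} p≢i p≢j with cover p
    ... | inj₁ (inj₁ p≡i) = contradiction p≡i p≢i
    ... | inj₁ (inj₂ p≡j) = contradiction p≡j p≢j
    ... | inj₂ h = h
    onA = twoOnArc⇒⊥ D recolor Ss
    onB = twoOnArc⇒⊥ (swapArcs D) recolor Ss
    go : A p ⊎ B p → A q ⊎ B q → A r ⊎ B r → ⊥
    go (inj₁ Ap) (inj₁ Aq) r∈ = onA Ap Aq (≢-sym q≢p) r≢p r≢q r∈
    go (inj₁ Ap) (inj₂ Bq) (inj₁ Ar) = onA Ap Ar (≢-sym r≢p) q≢p (≢-sym r≢q) (inj₂ Bq)
    go (inj₁ Ap) (inj₂ Bq) (inj₂ Br) = onB Bq Br (≢-sym r≢q) (≢-sym q≢p) (≢-sym r≢p) (inj₂ Ap)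
    go (inj₂ Bp) (inj₁ Aq) (inj₁ Ar) = onA Aq Ar (≢-sym r≢q) (≢-sym q≢p) (≢-sym r≢p) (inj₂ Bp)
    go (inj₂ Bp) (inj₁ Aq) (inj₂ Br) = onB Bp Br (≢-sym r≢p) q≢p (≢-sym r≢q) (inj₂ Aq)
    go (inj₂ Bp) (inj₂ Bq) r∈ = onB Bp Bq (≢-sym q≢p) r≢p r≢q (Sum.swap r∈)

-- Colourings of the cycle

-- Vertex suc n of a walk lies between the edges n and suc n.
record Walk (E T : ℕ → Color) : Set where
  field
    edges : ∀ n → E n ≢ E (suc n)
    left  : ∀ n → T (suc n) ≢ E n
    right : ∀ n → T (suc n) ≢ E (suc n)

  vertexColor : ∀ n → T (suc n) ≡ third (E n) (E (suc n))
  vertexColor n = third-unique _ _ _ (edges n) (left n) (right n)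

  nextEdge : ∀ n → E (suc n) ≡ third (E n) (T (suc n))
  nextEdge n = sym (third-≡ (≢-sym (left n)) (≢-sym (edges n)) (≢-sym (right n)))

  prevEdge : ∀ n → E n ≡ third (E (suc n)) (T (suc n))
  prevEdge n = sym (third-≡ (≢-sym (right n)) (edges n) (≢-sym (left n)))

opaque

  -- A vertex coloured `t` and `third c t` by the two colourings, with `p` on the edge where they
  -- agree. So `p` avoids both vertex colours and is `c`; then `q` and `q′` are these two colours,
  -- and the one they miss is `c`.
  oneSideDiffers : ∀ c t p q q′ → t ≢ c → t ≢ p → third c t ≢ p → t ≢ q →
                   third c t ≢ q′ → q ≢ q′ → p ≢ q → p ≢ q′ →
                   p ≡ c × third q q′ ≡ c
  oneSideDiffers = toWitness
    {a? = all? λ c → all? λ t → all? λ p → all? λ q → all? λ q′ →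
      ¬? (t ≟ c) →-dec (¬? (t ≟ p) →-dec (¬? (third c t ≟ p) →-dec
      (¬? (t ≟ q) →-dec (¬? (third c t ≟ q′) →-dec (¬? (q ≟ q′) →-dec
      (¬? (p ≟ q) →-dec (¬? (p ≟ q′) →-dec
      ((p ≟ c) ×-dec (third q q′ ≟ c)))))))))} _

  -- The edges at the vertex are coloured `c` and `third c t` by one colouring, `c` and `t` by the
  -- other. As they agree on neither edge, `c` moves from one edge to the other, and the colours
  -- missed on the two edges are `t` and `third c t` in some order.
  bothSidesDiffer : ∀ c t p p′ q q′ → t ≢ c → p ≢ q → p′ ≢ q′ →
                    t ≢ p → t ≢ q → third c t ≢ p′ → third c t ≢ q′ →
                    p ≢ p′ → q ≢ q′ →
                    third q q′ ≢ c × third p p′ ≢ c × third q q′ ≢ third p p′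
  bothSidesDiffer = toWitness
    {a? = all? λ c → all? λ t → all? λ p → all? λ p′ → all? λ q → all? λ q′ →
      ¬? (t ≟ c) →-dec (¬? (p ≟ q) →-dec (¬? (p′ ≟ q′) →-dec
      (¬? (t ≟ p) →-dec (¬? (t ≟ q) →-dec (¬? (third c t ≟ p′) →-dec
      (¬? (third c t ≟ q′) →-dec (¬? (p ≟ p′) →-dec (¬? (q ≟ q′) →-dec
      (¬? (third q q′ ≟ c) ×-dec (¬? (third p p′ ≟ c) ×-dec
       ¬? (third q q′ ≟ third p p′)))))))))))} _

module _ {E T E′ T′} (W : Walk E T) (W′ : Walk E′ T′) where
  private
    module W  = Walk W
    module W′ = Walk W′

  -- Where the colourings disagree, this is the colour that neither gives to the edge, hence the
  -- only possible colour of an adjacent vertex on which they agree. This is why arcs of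
  -- disagreement are constant.
  difference : ℕ → Color
  difference n = third (E n) (E′ n)

  AgreeBetween : ℕ → ℕ → Set
  AgreeBetween l u = ∀ n → l ≤ n → n < u → T (suc n) ≡ T′ (suc n)

  agree-step : ∀ n → T (suc n) ≡ T′ (suc n) → E n ≡ E′ n → E (suc n) ≡ E′ (suc n)
  agree-step n t≡ e≡ =
    trans (W.nextEdge n) (trans (cong₂ third e≡ t≡) (sym (W′.nextEdge n)))

  agree-back : ∀ n → T (suc n) ≡ T′ (suc n) → E (suc n) ≡ E′ (suc n) → E n ≡ E′ n
  agree-back n t≡ e≡ =
    trans (W.prevEdge n) (trans (cong₂ third e≡ t≡) (sym (W′.prevEdge n)))

  agree-along : ∀ {l u} → AgreeBetween l u → E l ≡ E′ l → l ≤ u → E u ≡ E′ u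
  agree-along {l} {u} same e≡ l≤u = go (≤⇒≤′ l≤u) ≤-refl
    where
    go : ∀ {n} → l ≤′ n → n ≤ u → E n ≡ E′ n
    go ≤′-refl       _   = e≡
    go (≤′-step l≤n) n<u =
      agree-step _ (same _ (≤′⇒≤ l≤n) n<u) (go l≤n (<⇒≤ n<u))

  vertex≡difference : ∀ n → T (suc n) ≡ T′ (suc n) → E n ≢ E′ n →
                      T (suc n) ≡ difference n
  vertex≡difference n t≡ e≢ =
    third-unique _ _ _ e≢ (W.left n) (λ eq → W′.left n (trans (sym t≡) eq))

  difference-step : ∀ n → T (suc n) ≡ T′ (suc n) → E n ≢ E′ n →
                    difference (suc n) ≡ difference n
  difference-step n t≡ e≢ = trans
    (sym (third-unique _ _ _ (e≢ ∘ agree-back n t≡) (W.right n)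
      (λ eq → W′.right n (trans (sym t≡) eq))))
    (vertex≡difference n t≡ e≢)

  differ-along : ∀ {l u} → AgreeBetween l u → E l ≢ E′ l →
                 ∀ {n} → l ≤ n → n ≤ u → E n ≢ E′ n × difference n ≡ difference l
  differ-along {l} {u} same e≢ l≤n = go (≤⇒≤′ l≤n)
    where
    go : ∀ {n} → l ≤′ n → n ≤ u → E n ≢ E′ n × difference n ≡ difference l
    go ≤′-refl       _   = e≢ , refl
    go (≤′-step {n} l≤n) n<u with ih , d≡ ← go l≤n (<⇒≤ n<u) =
      ih ∘ agree-back n t≡ , trans (difference-step n t≡ ih) d≡
      where t≡ = same n (≤′⇒≤ l≤n) n<u

  constant-along : ∀ {l u} → AgreeBetween l u → E l ≢ E′ l →
                   ∀ {n} → l ≤ n → n < u → T (suc n) ≡ difference l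
  constant-along same e≢ {n} l≤n n<u with d≢ , d≡ ← differ-along same e≢ l≤n (<⇒≤ n<u) =
    trans (vertex≡difference n (same n l≤n n<u) d≢) d≡

  record Switched (c : Color) (n : ℕ) : Set where
    constructor switched
    field
      ≢c  : T n ≢ c
      ≡τ  : T′ n ≡ third c (T n)
  open Switched

  record OnlyHereDiffers (c : Color) (l u : ℕ) : Set where
    field
      between  : ∀ {n} → suc l ≤ n → n < u → T (suc n) ≡ c
      beyond   : T (suc (suc u)) ≢ c
      inhabited : T (suc l) ≢ T (suc u) → suc l < u

  -- By `oneSideDiffers` at both switched vertices, the outer edges `l` and `suc u` are coloured
  -- `c`, and so is everything strictly between. The vertex beyond meets an outer edge, so it is not
  -- `c`. Adjacent switched vertices would share their inner edge and hence have equal colours.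
  onlyHereDiffers : ∀ {c l u} → l < u → Switched c (suc l) → Switched c (suc u) →
    AgreeBetween (suc l) u → E l ≡ E′ l → E (suc u) ≡ E′ (suc u) →
    E (suc l) ≢ E′ (suc l) → OnlyHereDiffers c l u
  onlyHereDiffers {c} {l} {u} l<u sl su same el≡ eu≡ e≢ = record
    { between   = λ l<n n<u → trans (constant-along same e≢ l<n n<u) (proj₂ atL)
    ; beyond    = λ eq → W.left (suc u) (trans eq (sym (proj₁ atU)))
    ; inhabited = λ t≢ → ≤∧≢⇒< l<u (λ { refl → t≢ (begin
        T (suc l)                     ≡⟨ W.vertexColor l ⟩
        third (E l) (E (suc l))       ≡⟨ cong (λ x → third x (E (suc l))) l≡u ⟩
        third (E (suc u)) (E (suc l)) ≡⟨ third-comm (E (suc u)) _ ⟩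
        third (E (suc l)) (E (suc u)) ≡⟨ W.vertexColor u ⟨
        T (suc u)                     ∎) })
    }
    where
    open ≡-Reasoning
    atL : E l ≡ c × difference (suc l) ≡ c
    atL = oneSideDiffers c (T (suc l)) (E l) (E (suc l)) (E′ (suc l)) (≢c sl) (W.left l)
      (λ eq → W′.left l (trans (≡τ sl) (trans eq el≡))) (W.right l)
      (λ eq → W′.right l (trans (≡τ sl) eq)) e≢ (W.edges l)
      (λ eq → W′.edges l (trans (sym el≡) eq))
    atU : E (suc u) ≡ c × difference u ≡ c
    atU = oneSideDiffers c (T (suc u)) (E (suc u)) (E u) (E′ u) (≢c su) (W.right u)
      (λ eq → W′.right u (trans (≡τ su) (trans eq eu≡))) (W.left u)
      (λ eq → W′.left u (trans (≡τ su) eq))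
      (proj₁ (differ-along same e≢ l<u ≤-refl)) (≢-sym (W.edges u))
      (λ eq → W′.edges u (sym (trans (sym eu≡) eq)))
    l≡u : E l ≡ E (suc u)
    l≡u = trans (proj₁ atL) (sym (proj₁ atU))

  differAround : ∀ {c} n → Switched c (suc n) → E n ≢ E′ n → E (suc n) ≢ E′ (suc n) →
    difference (suc n) ≢ c × difference n ≢ c × difference (suc n) ≢ difference n
  differAround {c} n sn = bothSidesDiffer c (T (suc n)) (E n) (E′ n) (E (suc n)) (E′ (suc n))
    (≢c sn) (W.edges n) (W′.edges n) (W.left n) (W.right n)
    (λ eq → W′.left n (trans (≡τ sn) eq)) (λ eq → W′.right n (trans (≡τ sn) eq))

  ¬agreeAround : ∀ {c} n → Switched c (suc n) → E n ≡ E′ n → E (suc n) ≡ E′ (suc n) → ⊥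
  ¬agreeAround {c} n sn e≡ e≡′ = third-≢ʳ c (T (suc n)) (≢c sn) (sym (begin
    T (suc n)                   ≡⟨ W.vertexColor n ⟩
    third (E n) (E (suc n))     ≡⟨ cong₂ third e≡ e≡′ ⟩
    third (E′ n) (E′ (suc n))   ≡⟨ W′.vertexColor n ⟨
    T′ (suc n)                  ≡⟨ ≡τ sn ⟩
    third c (T (suc n))         ∎))
    where open ≡-Reasoning

-- Unrolling the cycle along the natural numbers

position : ∀ {k} → ℕ → Fin (suc k)
position zero    = zero
position (suc n) = next (position n)

next-injective : ∀ {m} {p q : Fin m} → next p ≡ next q → p ≡ q
next-injective {suc k} {p} {q} eq with view p | view q
... | ‵fromℕ     | ‵fromℕ     = refl
... | ‵fromℕ     | ‵inject₁ _ = contradiction eq λ ()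
... | ‵inject₁ _ | ‵fromℕ     = contradiction eq λ ()
... | ‵inject₁ _ | ‵inject₁ _ = cong inject₁ (suc-injective eq)

toℕ-next : ∀ {k} (p : Fin (suc k)) → toℕ p < k → toℕ (next p) ≡ suc (toℕ p)
toℕ-next {k} p p<k with view p
... | ‵fromℕ     = contradiction (subst (_< k) (toℕ-fromℕ k) p<k) (<-irrefl refl)
... | ‵inject₁ q = cong suc (sym (toℕ-inject₁ q))

module _ {k : ℕ} where
  private
    m = suc k
    σ = position {k}

  toℕ-position : ∀ n → n < m → toℕ (σ n) ≡ n
  toℕ-position zero    _   = refl
  toℕ-position (suc n) n<k =
    trans (toℕ-next (σ n) (subst (_< k) (sym ih) (s≤s⁻¹ n<k))) (cong suc ih)
    where ih = toℕ-position n (<⇒≤ n<k)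

  position-toℕ : ∀ p → σ (toℕ p) ≡ p
  position-toℕ p = toℕ-injective (toℕ-position (toℕ p) (toℕ<n p))

  position-wrap : σ m ≡ zero
  position-wrap
    rewrite toℕ-injective {i = σ k} {j = fromℕ k}
              (trans (toℕ-position k ≤-refl) (sym (toℕ-fromℕ k)))
          | view-fromℕ k = refl

  position-periodic : ∀ n → σ (n + m) ≡ σ n
  position-periodic zero    = position-wrap
  position-periodic (suc n) = cong next (position-periodic n)

  position-shift : ∀ l d → σ (l + d) ≡ σ l → σ d ≡ zero
  position-shift zero    d eq = eq
  position-shift (suc l) d eq = position-shift l d (next-injective eq)

  position-distinct : ∀ {l n} → l < n → n < l + m → σ n ≢ σ l
  position-distinct {l} {n} l<n n<l+m eq with d , refl ← m≤n⇒∃[o]m+o≡n (<⇒≤ l<n) =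
    <-irrefl (sym d≡0) (+-cancelˡ-< l 0 d (subst (_< l + d) (sym (+-identityʳ l)) l<n))
    where
    d≡0 : d ≡ 0
    d≡0 = trans (sym (toℕ-position d (+-cancelˡ-< l d m n<l+m))) (cong toℕ (position-shift l d eq))

record CycleColoring {m} (s : State m) : Set where
  field
    edge  : Fin m → Color
    edges : ∀ p → edge p ≢ edge (next p)
    left  : ∀ p → s (next p) ≢ edge p
    right : ∀ p → s (next p) ≢ edge (next p)

walk : ∀ {k} {s : State (suc k)} (φ : CycleColoring s) →
       Walk (CycleColoring.edge φ ∘ position) (s ∘ position)
walk φ = record
  { edges = edges ∘ position ; left = left ∘ position ; right = right ∘ position }
  where open CycleColoring φ

-- The arcs cut off by two positions that can be switched together

module _ {k : ℕ} {S : State (suc k) → Set}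
         (cycle : ∀ {s} → S s → CycleColoring s) {i j : Fin (suc k)} (i<j : toℕ i < toℕ j)
         (pairSwitch : ∀ {s} → S s → ∀ c → s i ≢ c → s j ≢ c → S (switch c i j s)) where
  private
    m = suc k
    σ = position {k}
    u v : ℕ
    -- `suc u` is `toℕ i` plus a full turn `m`. Starting one turn late gives vertex `i` a preceding
    -- edge `u` even when `i` is zero.
    u = toℕ i + k
    v = toℕ j + k

    u<v : u < v
    u<v = +-monoˡ-< k i<j

    within-turn : ∀ (p r : Fin m) → toℕ p + k < toℕ r + k + m
    within-turn p r = <-≤-trans (+-monoˡ-< k (toℕ<n p))
      (≤-trans (≤-reflexive (+-comm m k)) (+-monoˡ-≤ m (m≤n+m k (toℕ r))))

    v<u+m : v < u + m
    v<u+m = within-turn j i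

    σu : ∀ p → σ (suc (toℕ p + k)) ≡ p
    σu p = trans (cong σ (sym (+-suc (toℕ p) k)))
      (trans (position-periodic (toℕ p)) (position-toℕ p))

    σu+m : σ (suc (u + m)) ≡ i
    σu+m = trans (cong next (position-periodic u)) (σu i)

    -- The positions strictly between the walk vertices `suc l` and `suc h`. Thus `A` runs from `i`
    -- to `j`, and `B` from `j` to the next visit of `i`, at `suc (u + m)`.
    Arc : ℕ → ℕ → Fin m → Set
    Arc l h p = ∃[ n ] suc l ≤ n × n < h × σ (suc n) ≡ p

    A B : Fin m → Set
    A = Arc u v
    B = Arc v (u + m)

    A-≢i : ∀ {p} → A p → p ≢ i
    A-≢i (n , u<n , n<v , refl) eq =
      position-distinct (s≤s u<n) (s≤s (<-trans n<v v<u+m)) (trans eq (sym (σu i)))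

    A-≢j : ∀ {p} → A p → p ≢ j
    A-≢j (n , u<n , n<v , refl) eq =
      position-distinct (s≤s n<v) (s≤s (<-trans v<u+m (+-monoˡ-< m u<n))) (trans (σu j) (sym eq))

    B-≢i : ∀ {p} → B p → p ≢ i
    B-≢i (n , v<n , n<u+m , refl) eq =
      position-distinct (s≤s n<u+m) (s≤s (+-monoˡ-< m (<-trans u<v v<n))) (trans σu+m (sym eq))

    B-≢j : ∀ {p} → B p → p ≢ j
    B-≢j (n , v<n , n<u+m , refl) eq =
      position-distinct (s≤s v<n) (s≤s (<-trans n<u+m (+-monoˡ-< m u<v))) (trans eq (sym (σu j)))

    arc-end : ∀ {l h p} → Arc l h p → Arc l h (σ (suc (suc l)))
    arc-end (n , l<n , n<h , _) = _ , ≤-refl , ≤-<-trans l<n n<h , refl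

    cover : ∀ p → (p ≡ i ⊎ p ≡ j) ⊎ (A p ⊎ B p)
    cover p with <-cmp (toℕ p) (toℕ i) | <-cmp (toℕ p) (toℕ j)
    ... | tri≈ _ p≡i _ | _ = inj₁ (inj₁ (toℕ-injective p≡i))
    ... | _ | tri≈ _ p≡j _ = inj₁ (inj₂ (toℕ-injective p≡j))
    ... | tri< p<i _ _ | _ = inj₂ (inj₂
      ( toℕ p + k + m , within-turn j p
      , +-monoˡ-< m (+-monoˡ-< k p<i)
      , trans (cong next (position-periodic (toℕ p + k))) (σu p) ))
    ... | tri> _ _ i<p | tri< p<j _ _ =
      inj₂ (inj₁ (toℕ p + k , +-monoˡ-< k i<p , +-monoˡ-< k p<j , σu p))
    ... | tri> _ _ _ | tri> _ _ j<p = inj₂ (inj₂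
      (toℕ p + k , +-monoˡ-< k j<p , within-turn p i , σu p))

  module _ {s} (Ss : S s) (c : Color) (i≢c : s i ≢ c) (j≢c : s j ≢ c) where
    private
      s′ : State m
      s′ = switch c i j s
      φ φ′ : CycleColoring _
      φ  = cycle Ss
      φ′ = cycle (pairSwitch Ss c i≢c j≢c)
      E E′ T T′ : ℕ → Color
      E  = CycleColoring.edge φ ∘ σ
      E′ = CycleColoring.edge φ′ ∘ σ
      T  = s ∘ σ
      T′ = s′ ∘ σ
      W  = walk φ
      W′ = walk φ′

      switchedAt : ∀ {n p} → σ n ≡ p → s p ≢ c → s′ p ≡ third c (s p) → Switched W W′ c n
      switchedAt refl = switched

      swᵢ : Switched W W′ c (suc u)
      swᵢ = switchedAt (σu i) i≢c (switchˡ c i j s)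
      swⱼ : Switched W W′ c (suc v)
      swⱼ = switchedAt (σu j) j≢c (switchʳ c i j s)
      swᵢ′ : Switched W W′ c (suc (u + m))
      swᵢ′ = switchedAt σu+m i≢c (switchˡ c i j s)

      onA : AgreeBetween W W′ (suc u) v
      onA n l h = sym (switch-other c i j s (A-≢i (n , l , h , refl)) (A-≢j (n , l , h , refl)))
      onB : AgreeBetween W W′ (suc v) (u + m)
      onB n l h = sym (switch-other c i j s (B-≢i (n , l , h , refl)) (B-≢j (n , l , h , refl)))

      E-periodic : ∀ n → E (n + m) ≡ E n
      E-periodic n = cong (CycleColoring.edge φ) (position-periodic n)
      E′-periodic : ∀ n → E′ (n + m) ≡ E′ n
      E′-periodic n = cong (CycleColoring.edge φ′) (position-periodic n)

      unwrap : E (u + m) ≡ E′ (u + m) → E u ≡ E′ u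
      unwrap eq = trans (sym (E-periodic u)) (trans eq (E′-periodic u))
      wrap : ∀ n → E n ≡ E′ n → E (n + m) ≡ E′ (n + m)
      wrap n eq = trans (E-periodic n) (trans eq (sym (E′-periodic n)))

      onArc : ∀ {l h d} → (∀ {n} → suc l ≤ n → n < h → T (suc n) ≡ d) → Constant s (Arc l h) d
      onArc f (n , l<n , n<h , refl) = f l<n n<h

    private
      Result : Set
      Result = Outcome s c i j A B (σ (suc (suc u))) (σ (suc (suc v)))

    -- The edges just after `i` and just after `j` decide everything, because agreement and
    -- disagreement both persist along an arc. Agreement on both arcs would give `i` the same colour
    -- before and after the switch.
    arcOutcome : Result
    arcOutcome with E (suc u) ≟ E′ (suc u) | E (suc v) ≟ E′ (suc v)
    ... | yes a≡ | yes b≡ =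
      ⊥-elim (¬agreeAround W W′ u swᵢ (unwrap (agree-along W W′ onB b≡ v<u+m)) a≡)
    ... | yes a≡ | no b≢ = cutoffʳ record
      { constant = onArc between
      -- `beyond` speaks of the position after the second visit of `i`, which is `a` again.
      ; boundary = λ eq → beyond (trans (cong (s ∘ next ∘ next) (position-periodic u)) eq)
      ; nonempty = λ i≢j → _ , _ , ≤-refl ,
          inhabited (λ eq → i≢j (sym (trans (cong s (sym (σu j))) (trans eq (cong s σu+m))))) , refl
      }
      where
      open OnlyHereDiffers (onlyHereDiffers W W′ v<u+m swⱼ swᵢ′ onB
        (agree-along W W′ onA a≡ u<v) (wrap (suc u) a≡) b≢)
    ... | no a≢ | yes b≡ = cutoffˡ record
      { constant = onArc between
      ; boundary = beyond
      ; nonempty = λ i≢j → _ , _ , ≤-refl ,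
          inhabited (λ eq → i≢j (trans (cong s (sym (σu i))) (trans eq (cong s (σu j))))) , refl
      }
      where
      open OnlyHereDiffers (onlyHereDiffers W W′ u<v swᵢ swⱼ onA
        (unwrap (agree-along W W′ onB b≡ v<u+m)) b≡ a≢)
    ... | no a≢ | no b≢ with around ← differAround W W′ (u + m) swᵢ′
              (proj₁ (differ-along W W′ onB b≢ v<u+m ≤-refl))
              (a≢ ∘ λ eq → trans (sym (E-periodic (suc u))) (trans eq (E′-periodic (suc u))))
      with d≡ ← proj₂ (differ-along W W′ onB b≢ v<u+m ≤-refl)
         | d′≡ ← cong₂ third (E-periodic (suc u)) (E′-periodic (suc u)) =
      twoColored
        (λ eq → proj₁ around (trans d′≡ eq))
        (λ eq → proj₁ (proj₂ around) (trans d≡ eq))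
        (λ eq → proj₂ (proj₂ around) (trans d′≡ (trans eq (sym d≡))))
        (onArc (constant-along W W′ onA a≢)) (onArc (constant-along W W′ onB b≢))

  arcs : Arcs S
  arcs = record
    { i = i ; j = j ; A = A ; B = B
    ; a = σ (suc (suc u)) ; b = σ (suc (suc v))
    ; cover = cover ; A-≢i = A-≢i ; A-≢j = A-≢j ; B-≢i = B-≢i ; B-≢j = B-≢j
    ; A-end = arc-end ; B-end = arc-end ; outcome = arcOutcome
    }

-- Kempe chains

opaque

  threeColors : ∀ (x y z k : Color) → x ≢ y → x ≢ z → y ≢ z → k ≢ x → k ≢ y → k ≡ z
  threeColors = toWitness
    {a? = all? λ x → all? λ y → all? λ z → all? λ k →
      ¬? (x ≟ y) →-dec (¬? (x ≟ z) →-dec (¬? (y ≟ z) →-dec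
      (¬? (k ≟ x) →-dec (¬? (k ≟ y) →-dec (k ≟ z)))))} _

module _ {A : Set} {P : A → Set} (P? : Decidable P) where

  length-filter-tabulate : ∀ {n} (f : Fin n → A) →
    length (filter P? (tabulate f)) ≡ ∑[ i < n ] indicator (P? (f i))
  length-filter-tabulate {zero}  f = refl
  length-filter-tabulate {suc n} f with P? (f zero)
  ... | yes _ = cong suc (length-filter-tabulate (f ∘ suc))
  ... | no _  = length-filter-tabulate (f ∘ suc)

  length-filter-++ : ∀ xs ys → length (filter P? (xs ++ ys)) ≡
                     length (filter P? xs) + length (filter P? ys)
  length-filter-++ xs ys =
    trans (cong length (filter-++ P? xs ys)) (length-++ (filter P? xs))

  length-filter-concat : ∀ {n} (f : Fin n → List A) →
    length (filter P? (concat (tabulate f))) ≡ ∑[ i < n ] length (filter P? (f i))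
  length-filter-concat {zero}  f = refl
  length-filter-concat {suc n} f =
    trans (length-filter-++ (f zero) _)
      (cong (length (filter P? (f zero)) +_) (length-filter-concat (f ∘ suc)))

least : {P : ℕ → Set} → Decidable P → ∀ n → P n →
        ∃[ l ] P l × (∀ {k} → k < l → ¬ P k)
least P? zero    p = zero , p , λ ()
least P? (suc n) p with P? zero
... | yes p₀ = zero , p₀ , λ ()
... | no ¬p₀ with l , pl , below ← least (P? ∘ suc) n p =
  suc l , pl , λ { {zero} _ → ¬p₀ ; {suc k} k<l → below (s<s⁻¹ k<l) }

module _ {m} (M : Multipole m) where

  infix 4 _≟ᵢ_

  _≟ᵢ_ : DecidableEquality (Incidence M)
  _≟ᵢ_ = Sum.≡-dec (Product.≡-dec _≟_ _≟_) _≟_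

  at? : ∀ v → Decidable (λ h → at M h ≡ inj₁ v)
  at? v h = Sum.≡-dec _≟_ _≟_ (at M h) (inj₁ v)

  private
    ends : Fin (nE M) → List (Incidence M)
    ends e = tabulate λ k → inj₁ (e , k)

    incidences : List (Incidence M)
    incidences = concat (tabulate ends) ++ tabulate inj₂

    ends-disjoint : ∀ {e e′} → e ≢ e′ → Disjoint (ends e) (ends e′)
    ends-disjoint {e} {e′} e≢e′ (h∈ , h∈′)
      with ∈-tabulate⁻ {f = λ k → inj₁ (e , k)} h∈ | ∈-tabulate⁻ {f = λ k → inj₁ (e′ , k)} h∈′
    ... | _ , refl | _ , refl = e≢e′ refl

    ends-semiedges-disjoint : Disjoint (concat (tabulate ends)) (tabulate inj₂)
    ends-semiedges-disjoint (h∈ , h∈′) with ∈-concat⁻′ (tabulate ends) h∈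
    ... | _ , h∈ends , ends∈ with ∈-tabulate⁻ {f = ends} ends∈
    ...   | e , refl with ∈-tabulate⁻ {f = λ k → inj₁ (e , k)} h∈ends | ∈-tabulate⁻ {f = inj₂} h∈′
    ...     | _ , refl | _ , ()

    ends-unique : ∀ e → Unique (ends e)
    ends-unique e = Unique.tabulate⁺ {f = λ k → inj₁ (e , k)}
      (Product.,-injectiveʳ ∘ Sum.inj₁-injective)

    incidences-unique : Unique incidences
    incidences-unique = Unique.++⁺
      (Unique.concat⁺ {xss = tabulate ends} (All.tabulate⁺ {f = ends} ends-unique)
        (AllPairs.tabulate⁺ {f = ends} ends-disjoint))
      (Unique.tabulate⁺ {f = inj₂} Sum.inj₂-injective)
      ends-semiedges-disjoint

    length-at : ∀ v → length (filter (at? v) incidences) ≡ degree M v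
    length-at v = trans (length-filter-++ (at? v) (concat (tabulate ends)) _)
      (cong₂ _+_
        (trans (length-filter-concat (at? v) ends)
          (sum-cong-≗ λ e → length-filter-tabulate (at? v) λ k → inj₁ (e , k)))
        (length-filter-tabulate (at? v) inj₂))

  -- `degree` counts the incidences at `v` in a list without repetitions, so filtering that list
  -- leaves exactly three distinct ones.
  threeIncidences : ∀ v → ∃[ h₁ ] ∃[ h₂ ] ∃[ h₃ ]
    (at M h₁ ≡ inj₁ v × at M h₂ ≡ inj₁ v × at M h₃ ≡ inj₁ v) ×
    (h₁ ≢ h₂ × h₁ ≢ h₃ × h₂ ≢ h₃)
  threeIncidences v
    with filter (at? v) incidences | trans (length-at v) (cubic M v)
       | Unique.filter⁺ (at? v) incidences-unique | All.all-filter (at? v) incidences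
  ... | h₁ ∷ h₂ ∷ h₃ ∷ [] | _ | (n₁₂ ∷ n₁₃ ∷ _) ∷ (n₂₃ ∷ _) ∷ _ | a₁ ∷ a₂ ∷ a₃ ∷ _ =
    h₁ , h₂ , h₃ , (a₁ , a₂ , a₃) , (n₁₂ , n₁₃ , n₂₃)

  -- Pointwise agreement instead of equality: states are treated as functions here, and a switched
  -- colouring matches `switch` only position by position.
  States : State m → Set
  States s = ∃[ φ ] (∀ p → color {M = M} φ (inj₂ p) ≡ s p)

  module _ (φ : TaitColoring M) where

    hue : Incidence M → Color
    hue h = color φ (underlying M h)

    incidenceOfColor : ∀ v k → ∃[ h ] at M h ≡ inj₁ v × hue h ≡ k
    incidenceOfColor v k
      with h₁ , h₂ , h₃ , (a₁ , a₂ , a₃) , (n₁₂ , n₁₃ , n₂₃) ← threeIncidences v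
      with hue h₁ ≟ k | hue h₂ ≟ k
    ... | yes eq | _      = h₁ , a₁ , eq
    ... | no _   | yes eq = h₂ , a₂ , eq
    ... | no k≢₁ | no k≢₂ = h₃ , a₃ , sym (threeColors (hue h₁) (hue h₂) (hue h₃) k
      (proper φ v h₁ h₂ a₁ a₂ n₁₂) (proper φ v h₁ h₃ a₁ a₃ n₁₃) (proper φ v h₂ h₃ a₂ a₃ n₂₃)
      (≢-sym k≢₁) (≢-sym k≢₂))

  opposite-fixedPointFree : (k : Fin 2) → opposite k ≢ k
  opposite-fixedPointFree zero    ()
  opposite-fixedPointFree (suc zero) ()

  -- Traverses an edge. Leaving semiedges in place makes this a total involution whose fixed points
  -- are exactly the semiedges, the places where a chain stops.
  cross : Incidence M → Incidence M
  cross (inj₁ (e , k)) = inj₁ (e , opposite k)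
  cross (inj₂ i)       = inj₂ i

  cross-involutive : ∀ h → cross (cross h) ≡ h
  cross-involutive (inj₁ (e , k)) = cong (λ k → inj₁ (e , k)) (opposite-involutive k)
  cross-involutive (inj₂ i)       = refl

  underlying-cross : ∀ h → underlying M (cross h) ≡ underlying M h
  underlying-cross (inj₁ _) = refl
  underlying-cross (inj₂ _) = refl

  cross-injective : ∀ h h′ → cross h ≡ cross h′ → h ≡ h′
  cross-injective h h′ eq =
    trans (sym (cross-involutive h)) (trans (cong cross eq) (cross-involutive h′))

  cross-fixed : ∀ h → cross h ≡ h → ∃[ i ] h ≡ inj₂ i
  cross-fixed (inj₁ (e , k)) eq =
    contradiction (Product.,-injectiveʳ (Sum.inj₁-injective eq)) (opposite-fixedPointFree k)
  cross-fixed (inj₂ i) _ = i , refl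

  incidence↣Fin : Incidence M ↣ Fin (nE M * 2 + m)
  incidence↣Fin = record
    { to = λ h → Inverse.from +↔⊎ (Sum.map₁ (Inverse.from *↔×) h)
    ; cong = cong _
    ; injective = λ {x} {y} eq → map₁-injective x y
        (inverse-injective +↔⊎ eq)
    }
    where
    inverse-injective : ∀ {A B : Set} (f : A ↔ B) {x y} →
                        Inverse.from f x ≡ Inverse.from f y → x ≡ y
    inverse-injective f {x} {y} eq = trans (sym (Inverse.strictlyInverseˡ f x))
      (trans (cong (Inverse.to f) eq) (Inverse.strictlyInverseˡ f y))
    map₁-injective : ∀ x y → Sum.map₁ (Inverse.from *↔×) x ≡ Sum.map₁ (Inverse.from *↔×) y → x ≡ y
    map₁-injective (inj₁ x) (inj₁ y) eq =
      cong inj₁ (inverse-injective *↔× (Sum.inj₁-injective eq))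
    map₁-injective (inj₂ x) (inj₂ y) refl = refl

  module Chain (φ : TaitColoring M) (c : Color) where

    Active : Incidence M → Set
    Active h = (∃[ v ] at M h ≡ inj₁ v) × hue φ h ≢ c

    partner : ∀ h → Active h → ∃[ h′ ] at M h′ ≡ at M h × hue φ h′ ≡ third c (hue φ h)
    partner h ((v , a) , _) with h′ , a′ , eq ← incidenceOfColor φ v (third c (hue φ h)) =
      h′ , trans a′ (sym a) , eq

    active? : Decidable Active
    active? h with at M h | hue φ h ≟ c
    ... | inj₁ v | no h≢c  = yes ((v , refl) , h≢c)
    ... | _      | yes h≡c = no λ a → proj₂ a h≡c
    ... | inj₂ _ | no _    = no λ { ((_ , ()) , _) }

    -- Passes through a vertex to the other incidence whose colour is not `c`. The value at inactive
    -- incidences is a mere default.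
    turn : Incidence M → Incidence M
    turn h with active? h
    ... | yes a = proj₁ (partner h a)
    ... | no _  = h

    turn-spec : ∀ {h} → Active h → at M (turn h) ≡ at M h × hue φ (turn h) ≡ third c (hue φ h)
    turn-spec {h} a with active? h
    ... | yes a′ = proj₂ (partner h a′)
    ... | no ¬a  = contradiction a ¬a

    turn-active : ∀ {h} → Active h → Active (turn h)
    turn-active a@((v , at≡) , h≢c) with at′ , hue′ ← turn-spec a =
      (v , trans at′ at≡) , λ eq → third-≢ˡ c _ h≢c (trans (sym hue′) eq)

    turn-≢ : ∀ {h} → Active h → turn h ≢ h
    turn-≢ a eq = third-≢ʳ c _ (proj₂ a) (trans (sym (proj₂ (turn-spec a))) (cong (hue φ) eq))

    turn-unique : ∀ {h h′} → Active h → at M h′ ≡ at M h →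
                  hue φ h′ ≡ third c (hue φ h) → h′ ≡ turn h
    turn-unique {h} {h′} a@((v , at≡) , _) at′≡ hue′≡ with h′ ≟ᵢ turn h
    ... | yes eq = eq
    ... | no h′≢ = contradiction (trans hue′≡ (sym (proj₂ (turn-spec a))))
      (proper φ v h′ (turn h) (trans at′≡ at≡) (trans (proj₁ (turn-spec a)) at≡) h′≢)

    turn-involutive : ∀ {h} → Active h → turn (turn h) ≡ h
    turn-involutive {h} a = sym (turn-unique (turn-active a) (sym (proj₁ (turn-spec a)))
      (sym (trans (cong (third c) (proj₂ (turn-spec a))) (third-involutive c _))))

    cross-active : ∀ {h} → Active h → Active (cross h)
    cross-active {inj₁ (e , k)} (_ , h≢c) = (end M e (opposite k) , refl) , h≢c
    cross-active {inj₂ i}       a         = a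

    module _ (p : Fin m) (p-active : Active (inj₂ p)) where

      track : ℕ → Incidence M
      track zero    = inj₂ p
      track (suc n) = cross (turn (track n))

      track-active : ∀ n → Active (track n)
      track-active zero    = p-active
      track-active (suc n) = cross-active (turn-active (track-active n))

      track-cancel : ∀ k n → track (suc k) ≡ track (suc n) → track k ≡ track n
      track-cancel k n eq = begin
        track k                ≡⟨ turn-involutive (track-active k) ⟨
        turn (turn (track k))  ≡⟨ cong turn (cross-injective (turn (track k)) (turn (track n)) eq) ⟩
        turn (turn (track n))  ≡⟨ turn-involutive (track-active n) ⟩
        track n                ∎
        where open ≡-Reasoning

      track-shift : ∀ l d → track l ≡ track (l + d) → track zero ≡ track d
      track-shift zero    d eq = eq
      track-shift (suc l) d eq = track-shift l d (track-cancel l (l + d) eq)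

      Exit : ℕ → Set
      Exit n = ∃[ i ] turn (track n) ≡ inj₂ i

      exit? : Decidable Exit
      exit? n with turn (track n)
      ... | inj₁ _ = no λ ()
      ... | inj₂ i = yes (i , refl)

      -- Two equal terms of the track can be shifted back to its start, since `turn` and `cross` can
      -- be undone. The track thus comes back to `p`, which is itself an exit; that the first exit
      -- is a different semiedge is shown in `q≢p`.
      someExit : ∃ Exit
      someExit
        with pigeonhole (n<1+n (nE M * 2 + m)) (Injection.to incidence↣Fin ∘ track ∘ toℕ)
      ... | k , n , k<n , eq with d , k+1+d≡n ← m≤n⇒∃[o]m+o≡n k<n =
        d , p , cross-injective (turn (track d)) (inj₂ p) (sym
          (track-shift (toℕ k) (suc d) (trans (Injection.injective incidence↣Fin eq)
            (cong track (trans (sym k+1+d≡n) (sym (+-suc (toℕ k) d)))))))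

      opaque

        firstExit : ∃[ l ] Exit l × (∀ {k} → k < l → ¬ Exit k)
        firstExit = least exit? (proj₁ someExit) (proj₂ someExit)

      ℓ : ℕ
      ℓ = proj₁ firstExit

      q : Fin m
      q = proj₁ (proj₁ (proj₂ firstExit))

      turn-ℓ : turn (track ℓ) ≡ inj₂ q
      turn-ℓ = proj₂ (proj₁ (proj₂ firstExit))

      exit-≥ℓ : ∀ {k} → k < ℓ → ¬ Exit k
      exit-≥ℓ = proj₂ (proj₂ firstExit)

      -- A track returning to its start would be traversed palindromically, and
      -- its middle would be fixed by turn or be an earlier exit.
      ¬palindrome : ∀ n k → n + k ≤ ℓ → track (n + k) ≢ turn (track k)
      ¬palindrome zero          k _ eq = turn-≢ (track-active k) (sym eq)
      ¬palindrome (suc zero)    k k<ℓ eq = exit-≥ℓ k<ℓ (cross-fixed (turn (track k)) eq)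
      ¬palindrome (suc (suc n)) k n≤ℓ eq = ¬palindrome n (suc k)
        (subst (_≤ ℓ) (sym (+-suc n k)) (<⇒≤ n≤ℓ)) (begin
          track (n + suc k)                       ≡⟨ cong track (+-suc n k) ⟩
          track (suc n + k)                       ≡⟨ turn-involutive (track-active (suc n + k)) ⟨
          turn (turn (track (suc n + k)))
            ≡⟨ cong turn (cross-involutive (turn (track (suc n + k)))) ⟨
          turn (cross (track (suc (suc n) + k)))  ≡⟨ cong (turn ∘ cross) eq ⟩
          turn (track (suc k))                    ∎)
        where open ≡-Reasoning

      q≢p : q ≢ p
      q≢p q≡p = ¬palindrome ℓ zero (subst (_≤ ℓ) (sym (+-identityʳ ℓ)) ≤-refl) (begin
        track (ℓ + zero)       ≡⟨ cong track (+-identityʳ ℓ) ⟩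
        track ℓ                ≡⟨ turn-involutive (track-active ℓ) ⟨
        turn (turn (track ℓ))  ≡⟨ cong turn (trans turn-ℓ (cong inj₂ q≡p)) ⟩
        turn (track zero)      ∎)
        where open ≡-Reasoning

      -- Both sides of every vertex passed are included. Hence the chain is closed under `turn`,
      -- which keeps the switched colouring proper, and under `cross`, which makes it well defined
      -- on edges.
      OnChain : Incidence M → Set
      OnChain h = ∃[ n ] n < suc ℓ × (track n ≡ h ⊎ turn (track n) ≡ h)

      onChain? : Decidable OnChain
      onChain? h = anyUpTo? (λ n → (track n ≟ᵢ h) ⊎-dec (turn (track n) ≟ᵢ h)) (suc ℓ)

      onChain-active : ∀ {h} → OnChain h → Active h
      onChain-active (n , _ , inj₁ refl) = track-active n
      onChain-active (n , _ , inj₂ refl) = turn-active (track-active n)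

      onChain-turn : ∀ {h} → OnChain h → OnChain (turn h)
      onChain-turn (n , n≤ℓ , inj₁ refl) = n , n≤ℓ , inj₂ refl
      onChain-turn (n , n≤ℓ , inj₂ refl) = n , n≤ℓ , inj₁ (sym (turn-involutive (track-active n)))

      onChain-cross : ∀ {h} → OnChain h → OnChain (cross h)
      onChain-cross (zero  , n≤ℓ , inj₁ refl) = zero , n≤ℓ , inj₁ refl
      onChain-cross (suc n , n<ℓ , inj₁ refl) =
        n , <-trans (n<1+n n) n<ℓ , inj₂ (sym (cross-involutive (turn (track n))))
      onChain-cross (n , n≤ℓ , inj₂ refl) with m≤n⇒m<n∨m≡n (s≤s⁻¹ n≤ℓ)
      ... | inj₁ n<ℓ  = suc n , s≤s n<ℓ , inj₁ refl
      ... | inj₂ refl = n , n≤ℓ , inj₂ (trans turn-ℓ (cong cross (sym turn-ℓ)))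

      onChain-uncross : ∀ {h} → OnChain (cross h) → OnChain h
      onChain-uncross {h} on = subst OnChain (cross-involutive h) (onChain-cross on)

      onChain-semiedge : ∀ {r} → OnChain (inj₂ r) → r ≡ p ⊎ r ≡ q
      onChain-semiedge (zero , _ , inj₁ refl) = inj₁ refl
      onChain-semiedge (suc n , n<ℓ , inj₁ eq) = contradiction
        (_ , cross-injective (turn (track n)) (inj₂ _) eq) (exit-≥ℓ (s≤s⁻¹ n<ℓ))
      onChain-semiedge (n , n≤ℓ , inj₂ eq) with m≤n⇒m<n∨m≡n (s≤s⁻¹ n≤ℓ)
      ... | inj₁ n<ℓ  = contradiction (_ , eq) (exit-≥ℓ n<ℓ)
      ... | inj₂ refl = inj₂ (Sum.inj₂-injective (trans (sym eq) turn-ℓ))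

      p-onChain : OnChain (inj₂ p)
      p-onChain = zero , z<s , inj₁ refl

      q-onChain : OnChain (inj₂ q)
      q-onChain = ℓ , n<1+n ℓ , inj₂ turn-ℓ

      switchIf : ∀ {P : Set} → Dec P → Color → Color
      switchIf (yes _) = third c
      switchIf (no _)  = λ x → x

      switchIf-yes : ∀ {P : Set} (P? : Dec P) {x} → P → switchIf P? x ≡ third c x
      switchIf-yes (yes _) _ = refl
      switchIf-yes (no ¬p) p = contradiction p ¬p

      switchIf-no : ∀ {P : Set} (P? : Dec P) {x} → ¬ P → switchIf P? x ≡ x
      switchIf-no (yes p) ¬p = contradiction p ¬p
      switchIf-no (no _)  _  = refl

      switchedColor : Fin (nE M) ⊎ Fin m → Color
      -- Testing one end suffices, as the chain contains both ends of an edge or neither.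
      switchedColor (inj₁ e) = switchIf (onChain? (inj₁ (e , zero))) (color φ (inj₁ e))
      switchedColor (inj₂ i) = switchIf (onChain? (inj₂ i)) (color φ (inj₂ i))

      switched-on : ∀ h → OnChain h → switchedColor (underlying M h) ≡ third c (hue φ h)
      switched-on (inj₁ (e , zero))     on = switchIf-yes (onChain? _) on
      switched-on (inj₁ (e , suc zero)) on = switchIf-yes (onChain? _) (onChain-cross on)
      switched-on (inj₂ i)              on = switchIf-yes (onChain? _) on

      switched-off : ∀ h → ¬ OnChain h → switchedColor (underlying M h) ≡ hue φ h
      switched-off (inj₁ (e , zero))     off = switchIf-no (onChain? _) off
      switched-off (inj₁ (e , suc zero)) off = switchIf-no (onChain? _) (off ∘ onChain-uncross)
      switched-off (inj₂ i)              off = switchIf-no (onChain? _) off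

      -- An incidence at the same vertex with the switched colour of `h` is `turn h`, which is on
      -- the chain.
      switched-≢ : ∀ {v} h h′ → at M h ≡ inj₁ v → at M h′ ≡ inj₁ v → OnChain h → ¬ OnChain h′ →
                   third c (hue φ h) ≢ hue φ h′
      switched-≢ h h′ a a′ on off eq = off (subst OnChain
        (sym (turn-unique (onChain-active on) (trans a′ (sym a)) (sym eq))) (onChain-turn on))

      chainSwitch : TaitColoring M
      chainSwitch = record { color = switchedColor ; proper = proper′ ; free = free′ }
        where
        proper′ : ∀ v h h′ → at M h ≡ inj₁ v → at M h′ ≡ inj₁ v → h ≢ h′ →
                  switchedColor (underlying M h) ≢ switchedColor (underlying M h′)
        proper′ v h h′ a a′ h≢h′ eq with onChain? h | onChain? h′
        ... | yes on | yes on′ = proper φ v h h′ a a′ h≢h′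
          (third-injective c (trans (sym (switched-on h on)) (trans eq (switched-on h′ on′))))
        ... | yes on | no off′ = switched-≢ h h′ a a′ on off′
          (trans (sym (switched-on h on)) (trans eq (switched-off h′ off′)))
        ... | no off | yes on′ = switched-≢ h′ h a′ a on′ off
          (trans (sym (switched-on h′ on′)) (trans (sym eq) (switched-off h off)))
        ... | no off | no off′ = proper φ v h h′ a a′ h≢h′
          (trans (sym (switched-off h off)) (trans eq (switched-off h′ off′)))
        offChain : ∀ {i j} → attach M i ≡ inj₂ j → ¬ OnChain (inj₂ i)
        offChain eq on with (v , a) , _ ← onChain-active on = case trans (sym a) eq of λ ()
        free′ : ∀ i j → attach M i ≡ inj₂ j → switchedColor (inj₂ i) ≡ switchedColor (inj₂ j)
        free′ i j eq = trans (switched-off (inj₂ i) (offChain eq)) (trans (free φ i j eq)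
          (sym (switched-off (inj₂ j) (offChain (free-symmetric M i j eq)))))

-- Switches at a free edge, at a common vertex and along a chain

transpose-ˡ : ∀ {n} (i j : Fin n) → transpose i j i ≡ j
transpose-ˡ i j rewrite dec-true (i ≟ i) refl = refl

transpose-ʳ : ∀ {n} {i j : Fin n} → i ≢ j → transpose i j j ≡ i
transpose-ʳ {i = i} {j} i≢j
  rewrite dec-false (j ≟ i) (≢-sym i≢j) | dec-true (j ≟ j) refl = refl

transpose-other : ∀ {n} {i j k : Fin n} → k ≢ i → k ≢ j → transpose i j k ≡ k
transpose-other {i = i} {j} {k} k≢i k≢j
  rewrite dec-false (k ≟ i) k≢i | dec-false (k ≟ j) k≢j = refl

switch-unique : ∀ {m} {s t : State m} {c p q} → t p ≡ third c (s p) → t q ≡ third c (s q) →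
                (∀ r → r ≢ p → r ≢ q → t r ≡ s r) → ∀ r → t r ≡ switch c p q s r
switch-unique {s = s} {c = c} {p} {q} tp tq tr r = helper (r ≟ p) (r ≟ q)
  where
  helper : Dec (r ≡ p) → Dec (r ≡ q) → _ ≡ switch c p q s r
  helper (yes refl) _        = trans tp (sym (switchˡ c p q s))
  helper (no _) (yes refl)   = trans tq (sym (switchʳ c p q s))
  helper (no r≢p) (no r≢q)   = trans (tr r r≢p r≢q) (sym (switch-other c p q s r≢p r≢q))

module _ {m} (M : Multipole m) where

  PairSwitch : Fin m → Fin m → Set
  PairSwitch i j = ∀ {s} → States M s → ∀ c → s i ≢ c → s j ≢ c → States M (switch c i j s)

  module _ {i j} (i→j : attach M i ≡ inj₂ j) where

    private
      j→i : attach M j ≡ inj₂ i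
      j→i = free-symmetric M i j i→j

    freeEnds-≡ : ∀ {s} → States M s → s i ≡ s j
    freeEnds-≡ (φ , eq) = trans (sym (eq i)) (trans (free φ i j i→j) (eq j))

    freePairSwitch : PairSwitch i j
    freePairSwitch {s} Ss@(φ , eq) c _ _ =
      record { color = color′ ; proper = proper′ ; free = free′ } , λ _ → refl
      where
      s′ = switch c i j s
      color′ : Fin (nE M) ⊎ Fin m → Color
      color′ (inj₁ e) = color φ (inj₁ e)
      color′ (inj₂ r) = s′ r
      unchanged : ∀ r {v} → attach M r ≡ inj₁ v → s′ r ≡ color φ (inj₂ r)
      unchanged r a = trans (switch-other c i j s
        (λ { refl → case trans (sym a) i→j of λ () }) (λ { refl → case trans (sym a) j→i of λ () }))
        (sym (eq r))
      hue′ : ∀ h {v} → at M h ≡ inj₁ v → color′ (underlying M h) ≡ hue M φ h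
      hue′ (inj₁ _) _ = refl
      hue′ (inj₂ r) a = unchanged r a
      proper′ : ∀ v h h′ → at M h ≡ inj₁ v → at M h′ ≡ inj₁ v → h ≢ h′ →
                color′ (underlying M h) ≢ color′ (underlying M h′)
      proper′ v h h′ a a′ h≢h′ e =
        proper φ v h h′ a a′ h≢h′ (trans (sym (hue′ h a)) (trans e (hue′ h′ a′)))
      s′i≡s′j : s′ i ≡ s′ j
      s′i≡s′j = trans (switchˡ c i j s)
        (trans (cong (third c) (freeEnds-≡ Ss)) (sym (switchʳ c i j s)))
      free′ : ∀ k l → attach M k ≡ inj₂ l → s′ k ≡ s′ l
      free′ k l k→l with k ≟ i | k ≟ j
      ... | yes refl | _ = trans s′i≡s′j (cong s′ (Sum.inj₂-injective (trans (sym i→j) k→l)))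
      ... | _ | yes refl = trans (sym s′i≡s′j) (cong s′ (Sum.inj₂-injective (trans (sym j→i) k→l)))
      ... | no k≢i | no k≢j = trans (switch-other c i j s k≢i k≢j) (trans (sym (eq k))
        (trans (free φ k l k→l) (trans (eq l) (sym (switch-other c i j s l≢i l≢j)))))
        where
        l→k = free-symmetric M k l k→l
        l≢i : l ≢ i
        l≢i refl = k≢j (Sum.inj₂-injective (trans (sym l→k) i→j))
        l≢j : l ≢ j
        l≢j refl = k≢i (Sum.inj₂-injective (trans (sym l→k) j→i))

  module _ {i j v} (i≢j : i ≢ j) (i→v : attach M i ≡ inj₁ v) (j→v : attach M j ≡ inj₁ v) where

    cherry-≢ : ∀ {s} → States M s → s i ≢ s j
    cherry-≢ (φ , eq) e = proper φ v (inj₂ i) (inj₂ j) i→v j→v (i≢j ∘ Sum.inj₂-injective)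
      (trans (eq i) (trans e (sym (eq j))))

    private
      π : Fin m → Fin m
      π = transpose i j

      at-π : ∀ r → attach M (π r) ≡ attach M r
      at-π r = byCases (r ≟ i) (r ≟ j)
        where
        byCases : Dec (r ≡ i) → Dec (r ≡ j) → attach M (π r) ≡ attach M r
        byCases (yes refl) _ =
          trans (cong (attach M) (transpose-ˡ i j)) (trans j→v (sym i→v))
        byCases (no _) (yes refl) =
          trans (cong (attach M) (transpose-ʳ i≢j)) (trans i→v (sym j→v))
        byCases (no r≢i) (no r≢j) = cong (attach M) (transpose-other r≢i r≢j)

      exchange : Incidence M → Incidence M
      exchange = Sum.map₂ π

      at-exchange : ∀ h → at M (exchange h) ≡ at M h
      at-exchange (inj₁ _) = refl
      at-exchange (inj₂ r) = at-π r

      exchange-injective : ∀ h h′ → exchange h ≡ exchange h′ → h ≡ h′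
      exchange-injective (inj₁ _) (inj₁ _) refl = refl
      exchange-injective (inj₂ r) (inj₂ r′) eq = cong inj₂
        (trans (sym (transpose-inverse j i)) (trans (cong (transpose j i) (Sum.inj₂-injective eq))
          (transpose-inverse j i)))

      underlying-exchange : ∀ h → underlying M (exchange h) ≡ Sum.map₂ π (underlying M h)
      underlying-exchange (inj₁ _) = refl
      underlying-exchange (inj₂ _) = refl

    exchangeColoring : TaitColoring M → TaitColoring M
    exchangeColoring φ = record
      { color  = color φ ∘ Sum.map₂ π
      ; proper = λ v h h′ a a′ h≢h′ eq → proper φ v (exchange h) (exchange h′)
          (trans (at-exchange h) a) (trans (at-exchange h′) a′) (h≢h′ ∘ exchange-injective h h′)
          (trans (cong (color φ) (underlying-exchange h))
            (trans eq (cong (color φ) (sym (underlying-exchange h′)))))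
      ; free   = λ k l k→l → trans (cong (color φ ∘ inj₂) (unmoved k→l)) (trans (free φ k l k→l)
          (cong (color φ ∘ inj₂) (sym (unmoved (free-symmetric M k l k→l)))))
      }
      where
      unmoved : ∀ {k l} → attach M k ≡ inj₂ l → π k ≡ k
      unmoved k→l = transpose-other (λ { refl → case trans (sym k→l) i→v of λ () })
                                    (λ { refl → case trans (sym k→l) j→v of λ () })

    -- The semiedges `i` and `j` carry precisely the two colours other than `c`, so the switch
    -- amounts to exchanging them, which is harmless at a common vertex.
    cherryPairSwitch : PairSwitch i j
    cherryPairSwitch {s} Ss@(φ , eq) c si≢c sj≢c = exchangeColoring φ , switch-unique {s = s}
      (trans (eq _) (trans (cong s (transpose-ˡ i j))
        (sym (third-≡ (≢-sym si≢c) sj≢c (≢-sym (cherry-≢ Ss))))))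
      (trans (eq _) (trans (cong s (transpose-ʳ i≢j))
        (sym (third-≡ (≢-sym sj≢c) si≢c (cherry-≢ Ss)))))
      λ r r≢i r≢j → trans (eq _) (cong s (transpose-other r≢i r≢j))

  -- A free edge serves as its own chain; from a semiedge at a vertex, the chain of colours other
  -- than `c` leads to another semiedge.
  kempeClosed : KempeClosed (States M)
  kempeClosed {s} Ss@(φ , eq) c p sp≢c with attach M p in a
  ... | inj₂ j = j , ≢-sym (free-distinct M p j a) , sj≢c , freePairSwitch a Ss c sp≢c sj≢c
    where
    sj≢c : s j ≢ c
    sj≢c = sp≢c ∘ trans (freeEnds-≡ a Ss)
  ... | inj₁ v = Ch.q p act , Ch.q≢p p act , q≢c , Ch.chainSwitch p act , switch-unique {s = s}
      (trans (Ch.switched-on p act _ (Ch.p-onChain p act)) (cong (third c) (eq p)))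
      (trans (Ch.switched-on p act _ (Ch.q-onChain p act)) (cong (third c) (eq _)))
      λ r r≢p r≢q → trans
        (Ch.switched-off p act _ ([ r≢p , r≢q ]′ ∘ Ch.onChain-semiedge p act)) (eq r)
    where
    module Ch = Chain M φ c
    act : Ch.Active (inj₂ p)
    act = (v , a) , λ e → sp≢c (trans (sym (eq p)) e)
    q≢c : s (Ch.q p act) ≢ c
    q≢c e = proj₂ (Ch.onChain-active p act (Ch.q-onChain p act)) (trans (eq _) e)

-- Pigeonhole arguments and conclusion

pigeonRoom : ∀ {m} → 5 ≤ m → Roomy m
pigeonRoom {m} 5≤m v with any? (λ r → all? (λ k → ¬? (r ≟ v k)))
... | yes room = room
... | no full = collide (pigeonhole 5≤m (proj₁ ∘ hit))
  where
  hit : ∀ r → ∃[ k ] r ≡ v k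
  hit r with any? (λ k → r ≟ v k)
  ... | yes h = h
  ... | no ¬h = contradiction (r , λ k eq → ¬h (k , eq)) full
  collide : _ → _
  collide (r , r′ , r<r′ , eq) =
    contradiction (trans (proj₂ (hit r)) (trans (cong v eq) (sym (proj₂ (hit r′))))) (<⇒≢ r<r′)

Col⊆⇒cycleColoring : ∀ {m} {N : Multipole m} → (∀ {t} → Col N t → Col (C m) t) →
                     ∀ {s} → States N s → CycleColoring s
Col⊆⇒cycleColoring {m} N⊆C {s} (ψ , ψ≡s) with N⊆C (ψ , refl)
... | φ , φ≡ψ = record
  { edge  = color φ ∘ inj₁
  ; edges = λ p → proper φ (next p) (inj₁ (p , suc zero)) (inj₁ (next p , zero)) refl refl λ ()
  ; left  = λ p eq → proper φ (next p) (inj₂ (next p)) (inj₁ (p , suc zero)) refl refl (λ ())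
              (trans (agree (next p)) eq)
  ; right = λ p eq → proper φ (next p) (inj₂ (next p)) (inj₁ (next p , zero)) refl refl (λ ())
              (trans (agree (next p)) eq)
  }
  where
  agree : ∀ p → color φ (inj₂ p) ≡ s p
  agree p = trans (sym (lookup∘tabulate _ p))
    (trans (cong (λ t → Vec.lookup t p) φ≡ψ) (trans (lookup∘tabulate _ p) (ψ≡s p)))

data Bond {m} (N : Multipole m) : Set where
  freeEdge : ∀ {i j} → toℕ i < toℕ j → attach N i ≡ inj₂ j → Bond N
  cherry   : ∀ {i j v} → toℕ i < toℕ j → attach N i ≡ inj₁ v → attach N j ≡ inj₁ v → Bond N

bond : ∀ {m} (N : Multipole m) → nV N < m → Bond N
bond {m} N few with any? (λ i → any? (λ j → Sum.≡-dec _≟_ _≟_ (attach N i) (inj₂ j)))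
... | yes (i , j , i→j) with <-cmp (toℕ i) (toℕ j)
...   | tri< i<j _ _ = freeEdge i<j i→j
...   | tri≈ _ i≡j _ = contradiction (toℕ-injective i≡j) (free-distinct N i j i→j)
...   | tri> _ _ j<i = freeEdge j<i (free-symmetric N i j i→j)
bond {m} N few | no ¬free = collide (pigeonhole few (proj₁ ∘ vertex))
  where
  vertex : ∀ i → ∃[ v ] attach N i ≡ inj₁ v
  vertex i with attach N i in eq
  ... | inj₁ v = v , refl
  ... | inj₂ j = contradiction (i , j , eq) ¬free
  collide : _ → Bond N
  collide (i , j , i<j , eq) =
    cherry i<j (proj₂ (vertex i)) (trans (proj₂ (vertex j)) (cong inj₁ (sym eq)))

recolorable : ∀ {m} {N : Multipole m} (D : Arcs (States N)) → let open Arcs D in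
              PairSwitch N i j → (∀ {s} → States N s → s i ≡ s j) →
              ∀ {s} → States N s → ∀ d → ∃[ s′ ] States N s′ ×
              (s′ i ≡ d × s′ j ≡ d) × (∀ {r} → r ≢ i → r ≢ j → s′ r ≡ s r)
recolorable D pairSwitch same {s} Ss d with s (Arcs.i D) ≟ d
... | yes si≡d = s , Ss , (si≡d , trans (sym (same Ss)) si≡d) , λ _ _ → refl
... | no si≢d =
  switch c i j s , Ss′ , (s′i≡d , trans (sym (same Ss′)) s′i≡d) , switch-other c i j s
  where
  open Arcs D
  -- Fixing this colour, the switch takes `s i` to `d`.
  c = third (s i) d
  si≢c : s i ≢ c
  si≢c = ≢-sym (third-≢ˡ (s i) d (≢-sym si≢d))
  Ss′ = pairSwitch Ss c si≢c (si≢c ∘ trans (same Ss))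
  s′i≡d : switch c i j s i ≡ d
  s′i≡d = trans (switchˡ c i j s)
    (third-≡ (≢-sym si≢c) (≢-sym (third-≢ʳ (s i) d (≢-sym si≢d))) (≢-sym si≢d))

proposition7p4 : ∀ (m : ℕ) → 5 ≤ m → Irreducible (C m)
proposition7p4 (suc k) 5≤m (N , few , (_ , φ , _) , N⊆C) = impossible (bond N few)
  where
  cycle : ∀ {s} → States N s → CycleColoring s
  cycle = Col⊆⇒cycleColoring N⊆C
  room : Roomy (suc k)
  room = pigeonRoom 5≤m
  -- The nonemptiness of `Col N` provides the state from which both contradictions start.
  φ∈S : States N (color φ ∘ inj₂)
  φ∈S = φ , λ _ → refl
  impossible : Bond N → ⊥
  impossible (freeEdge i<j i→j) = free⇒⊥ (kempeClosed N) room D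
    (recolorable D (freePairSwitch N i→j) (freeEnds-≡ N i→j)) φ∈S
    where D = arcs cycle i<j (freePairSwitch N i→j)
  impossible (cherry i<j i→v j→v) = cherry⇒⊥ (kempeClosed N) room
    (arcs cycle i<j (cherryPairSwitch N (<⇒≢ i<j) i→v j→v)) (cherry-≢ N (<⇒≢ i<j) i→v j→v) φ∈S
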